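{- Let $G$ be a simple graph that is $\{ -1,0,1\}$-diagonalizable and has $p$ connected components with $v_1, v_2, \ldots, v_p$ vertices, respectively. Then the complement $G^{\textup{c}}$ is $\{ -1,0,1\}$-diagonalizable if and only if the vector $(v_1,v_2,\ldots,v_p)$ is balanced. Furthermore, if $G$ has $\{ -1,0,1\}$-bandwidth $k$, then $G^{\textup{c}}$ has $\{ -1,0,1\}$-bandwidth at most $\max\{p-1,k\}$.
   Context: For a simple graph on $n$ vertices with adjacency matrix $A$ and diagonal degree matrix $D$, the Laplacian is $L=D-A$. For a set $S$, a graph is $S$-diagonalizable if there is an invertible matrix $P$ all of whose entries lie in $S$ such that $P^{ -1}LP$ is diagonal (equivalently, a basis of eigenvectors of $L$ with entries in $S$). The bandwidth of a square matrix $M$ is the smallest positive integer $k$ such that $m_{i,j}=0$ whenever $|i-j|\ge k$ (diagonal matrices have bandwidth $1$, tridiagonal bandwidth $2$). The $\{ -1,0,1\}$-bandwidth of a graph is $\infty$ if it is not $\{ -1,0,1\}$-diagonalizable, and otherwise the smallest positive integer $k$ such that there is a matrix $P$ with entries in $\{ -1,0,1\}$, $P^{ -1}LP$ diagonal, and $P^TP$ of bandwidth $k$. A vector $\mathbf{v}\in\mathbb{R}^p$ with $p\ge 2$ is balanced if there exists a $(p-1)\times p$ matrix $A$ with all entries in $\{ -1,0,1\}$ whose null space equals $\mathrm{span}(\mathbf{v})$; by convention, a vector in $\mathbb{R}^1$ is balanced if and only if it is non-zero.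
   Formalization: The bandwidth bound is stated for a balanced vector (v_1,…,v_p), i.e. when the complement is { -1,0,1}-diagonalizable; otherwise the complement's bandwidth is ∞ and the bound fails (e.g. G = K1 ⊔ K2, whose complement is the path P3). -}

module Defs where

open import Data.Nat using (ℕ; zero; suc; _≤_; _<_; ∣_-_∣)
open import Data.Fin using (Fin; toℕ) renaming (zero to fzero; suc to fsuc)
open import Data.Fin.Properties using () renaming (_≟_ to _≟F_)
open import Data.Bool using (Bool; true; false; not; if_then_else_)
open import Data.Integer using (+_)
open import Data.Rational using (ℚ; 0ℚ; 1ℚ; -_; _+_; _-_; _*_; _/_)
open import Data.Product using (Σ; ∃; _×_; _,_)
open import Data.Sum using (_⊎_)
open import Relation.Nullary using (¬_; does)
open import Relation.Binary.PropositionalEquality using (_≡_; _≢_)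
open import Function.Bundles using (_⇔_)

Mat : ℕ → ℕ → Set
Mat m n = Fin m → Fin n → ℚ

Σℚ : (n : ℕ) → (Fin n → ℚ) → ℚ
Σℚ zero    f = 0ℚ
Σℚ (suc n) f = f fzero + Σℚ n (λ i → f (fsuc i))

_·_ : {m k n : ℕ} → Mat m k → Mat k n → Mat m n
_·_ {k = k} A B i j = Σℚ k (λ l → A i l * B l j)

transpose : {m n : ℕ} → Mat m n → Mat n m
transpose A i j = A j i

identity : (n : ℕ) → Mat n n
identity n i j = if does (i ≟F j) then 1ℚ else 0ℚ

Entries±1 : {m n : ℕ} → Mat m n → Set
Entries±1 A = ∀ i j → (A i j ≡ - 1ℚ) ⊎ (A i j ≡ 0ℚ) ⊎ (A i j ≡ 1ℚ)

IsDiagonal : {n : ℕ} → Mat n n → Set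
IsDiagonal M = ∀ i j → i ≢ j → M i j ≡ 0ℚ

-- matrix M has bandwidth at most k (k ≥ 1): m_ij = 0 whenever |i-j| ≥ k.
-- The bandwidth of M is the least positive such k.
BandwidthAtMost : {n : ℕ} → Mat n n → ℕ → Set
BandwidthAtMost M k = 1 ≤ k × (∀ i j → k ≤ ∣ toℕ i - toℕ j ∣ → M i j ≡ 0ℚ)

Adj : ℕ → Set
Adj n = Fin n → Fin n → Bool

IsSimple : {n : ℕ} → Adj n → Set
IsSimple a = (∀ i j → a i j ≡ a j i) × (∀ i → a i i ≡ false)

complement : {n : ℕ} → Adj n → Adj n
complement a i j = if does (i ≟F j) then false else not (a i j)

toℚ : Bool → ℚ
toℚ true  = 1ℚ
toℚ false = 0ℚ

adjacencyMatrix : {n : ℕ} → Adj n → Mat n n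
adjacencyMatrix a i j = toℚ (a i j)

degree : {n : ℕ} → Adj n → Fin n → ℚ
degree {n} a i = Σℚ n (λ j → toℚ (a i j))

degreeMatrix : {n : ℕ} → Adj n → Mat n n
degreeMatrix a i j = if does (i ≟F j) then degree a i else 0ℚ

laplacian : {n : ℕ} → Adj n → Mat n n
laplacian a i j = degreeMatrix a i j - adjacencyMatrix a i j

Diagonalizes : {n : ℕ} → Adj n → Mat n n → Set
Diagonalizes {n} a P =
  Σ (Mat n n) λ Q →
    (∀ i j → (Q · P) i j ≡ identity n i j) ×
    (∀ i j → (P · Q) i j ≡ identity n i j) ×
    IsDiagonal ((Q · laplacian a) · P)

Diagonalizable : {n : ℕ} → Adj n → Set
Diagonalizable {n} a = Σ (Mat n n) λ P → Entries±1 P × Diagonalizes a P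

BandWitness : {n : ℕ} → Adj n → ℕ → Set
BandWitness {n} a k =
  Σ (Mat n n) λ P → Entries±1 P × Diagonalizes a P × BandwidthAtMost (transpose P · P) k

HasBandwidth : {n : ℕ} → Adj n → ℕ → Set
HasBandwidth a k = 1 ≤ k × BandWitness a k × (∀ j → 1 ≤ j → j < k → ¬ BandWitness a j)

BandwidthGraphAtMost : {n : ℕ} → Adj n → ℕ → Set
BandwidthGraphAtMost a m = ∃ λ j → 1 ≤ j × j ≤ m × BandWitness a j

data Reachable {n : ℕ} (a : Adj n) : Fin n → Fin n → Set where
  here : ∀ {u} → Reachable a u u
  step : ∀ {u x w} → a u x ≡ true → Reachable a x w → Reachable a u w

IsComponentLabelling : {n p : ℕ} → Adj n → (Fin n → Fin p) → Set
IsComponentLabelling a c =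
  (∀ k → ∃ λ u → c u ≡ k) × (∀ u w → (c u ≡ c w) ⇔ Reachable a u w)

count : (n : ℕ) → (Fin n → Bool) → ℕ
count zero    b = 0
count (suc n) b = (if b fzero then 1 else 0) Data.Nat.+ count n (λ i → b (fsuc i))

componentSizes : {n p : ℕ} → (Fin n → Fin p) → Fin p → ℚ
componentSizes {n} c k = (+ count n (λ u → does (c u ≟F k))) / 1

nullSpaceIsSpan : {m p : ℕ} → Mat m p → (Fin p → ℚ) → Set
nullSpaceIsSpan {m} {p} A v =
  ∀ (x : Fin p → ℚ) →
    (∀ i → Σℚ p (λ j → A i j * x j) ≡ 0ℚ) ⇔ (∃ λ t → ∀ j → x j ≡ t * v j)

Balanced : (p : ℕ) → (Fin p → ℚ) → Set
Balanced (suc zero) v = v fzero ≢ 0ℚ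
Balanced p          v =
  Σ (Mat (p Data.Nat.∸ 1) p) λ A → Entries±1 A × nullSpaceIsSpan A v

{-# OPTIONS --safe #-}

-- Since L + Lᶜ = n I - J, a vector orthogonal to 1 is an eigenvector of L for μ iff it is an
-- eigenvector of Lᶜ for n - μ.  With at least two components the complement is connected, so the
-- kernel of Lᶜ is spanned by 1, and the n-eigenspace of Lᶜ consists of the vectors that are
-- constant on the components of G and orthogonal to 1, that is, of the lifts of the x in ℚᵖ with
-- Σ vₖ xₖ = 0.  The p - 1 columns of an eigenbasis of Lᶜ lying in that space are the rows of a
-- matrix with null space span v; conversely, the rows of such a matrix together with 1 replace
-- the kernel columns in an eigenbasis of L.  Placed last, they form a block of their own in PᵀP,
-- which gives the bandwidth bound.
module Submission where

open import Defs
open import Data.Bool using (Bool; true; false; not; _∧_; if_then_else_)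
open import Data.Bool.Properties using (∧-zeroʳ)
open import Data.Fin using (Fin; toℕ; cast; splitAt; join; punchIn; punchOut) renaming (zero to fzero; suc to fsuc)
open import Data.Fin.Properties
  using (any?; punchIn-punchOut; splitAt-join; join-splitAt; cast-involutive; toℕ-cast; toℕ-↑ˡ; toℕ-↑ʳ; toℕ<n)
  renaming (_≟_ to _≟F_)
open import Data.Integer as ℤ using ()
import Data.Integer.Properties as ℤ
open import Data.Nat as ℕ using (ℕ; zero; suc; _∸_; _⊔_; ∣_-_∣; s≤s)
import Data.Nat.Properties as ℕ
open import Data.Product using (Σ; ∃; _×_; _,_; proj₁; proj₂)
open import Data.Rational using (ℚ; 0ℚ; 1ℚ; -_; _+_; _-_; _*_; _/_; 1/_; _≤_; ≢-nonZero; nonNegative; nonPositive)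
open import Data.Rational.Properties
open import Data.Rational.Solver using (module +-*-Solver)
open import Data.Rational.Unnormalised as ℚᵘ using (mkℚᵘ; *≡*)
import Data.Rational.Unnormalised.Properties as ℚᵘ
open import Data.Sum using (_⊎_; inj₁; inj₂)
open import Function.Bundles using (_⇔_; mk⇔; module Equivalence)
open import Relation.Binary.PropositionalEquality
  using (_≡_; _≢_; refl; sym; trans; cong; cong₂; subst; subst₂; module ≡-Reasoning)
open import Relation.Nullary using (Dec; yes; no; ¬_; ¬?; does; contradiction)
open import Relation.Nullary.Decidable using (decidable-stable; dec-true; dec-false)
open ≡-Reasoning
open +-*-Solver using (solve; con; _:+_; _:*_; :-_; _:=_)

-- Linear algebra over ℚ

-- Columns of `P` that share an eigenvalue need not be orthogonal, so coordinates cannot be read off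
-- by inner products. Two facts replace this: eigenvectors for nonzero eigenvalues are orthogonal to
-- the kernel and, `P` being invertible, a vector orthogonal to all columns with nonzero eigenvalue
-- lies in the kernel. The second fact shows in one direction that the null space is no larger than
-- span v, and in the other that the new matrix is invertible. The sizes enter because the lifts of
-- x and y have inner product Σ vₖ xₖ yₖ: the lift of y is orthogonal to the lifted rows of A
-- exactly when the vector with entries vₖ yₖ is in the null space of A, and constant y give the
-- multiples of v. The bound is p - 1 rather than p because the all-ones column is orthogonal to
-- every other column; only the p - 1 lifted rows can interact, and their indices differ by at most
-- p - 2. With at most one component, kernel vectors of L are constant, and one matrix diagonalizes
-- both Laplacians.

Σ-cong : ∀ n {f g : Fin n → ℚ} → (∀ i → f i ≡ g i) → Σℚ n f ≡ Σℚ n g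
Σ-cong zero    eq = refl
Σ-cong (suc n) eq = cong₂ _+_ (eq fzero) (Σ-cong n λ i → eq (fsuc i))

Σ-zero : ∀ n {f : Fin n → ℚ} → (∀ i → f i ≡ 0ℚ) → Σℚ n f ≡ 0ℚ
Σ-zero zero    eq = refl
Σ-zero (suc n) eq = cong₂ _+_ (eq fzero) (Σ-zero n λ i → eq (fsuc i))

Σ-distrib-+ : ∀ n (f g : Fin n → ℚ) → Σℚ n (λ i → f i + g i) ≡ Σℚ n f + Σℚ n g
Σ-distrib-+ zero    f g = refl
Σ-distrib-+ (suc n) f g = trans
  (cong ((f fzero + g fzero) +_) (Σ-distrib-+ n f⁺ g⁺))
  (solve 4 (λ a b c d → (a :+ b) :+ (c :+ d) := (a :+ c) :+ (b :+ d)) refl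
    (f fzero) (g fzero) (Σℚ n f⁺) (Σℚ n g⁺))
  where
  f⁺ g⁺ : Fin n → ℚ
  f⁺ i = f (fsuc i)
  g⁺ i = g (fsuc i)

*-distribˡ-Σ : ∀ n c (f : Fin n → ℚ) → c * Σℚ n f ≡ Σℚ n (λ i → c * f i)
*-distribˡ-Σ zero    c f = *-zeroʳ c
*-distribˡ-Σ (suc n) c f = trans (*-distribˡ-+ c (f fzero) (Σℚ n λ i → f (fsuc i)))
  (cong (c * f fzero +_) (*-distribˡ-Σ n c (λ i → f (fsuc i))))

*-distribʳ-Σ : ∀ n c (f : Fin n → ℚ) → Σℚ n f * c ≡ Σℚ n (λ i → f i * c)
*-distribʳ-Σ n c f = trans (*-comm (Σℚ n f) c)
  (trans (*-distribˡ-Σ n c f) (Σ-cong n λ i → *-comm c (f i)))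

Σ-swap : ∀ m n (f : Fin m → Fin n → ℚ) →
  Σℚ m (λ i → Σℚ n (f i)) ≡ Σℚ n (λ j → Σℚ m (λ i → f i j))
Σ-swap zero    n f = sym (Σ-zero n λ j → refl)
Σ-swap (suc m) n f = trans (cong (Σℚ n (f fzero) +_) (Σ-swap m n (λ i → f (fsuc i))))
  (sym (Σ-distrib-+ n (f fzero) (λ j → Σℚ m λ i → f (fsuc i) j)))

δ : ∀ {n} → Fin n → Fin n → ℚ
δ i j = toℚ (does (i ≟F j))

δ-refl : ∀ {n} (i : Fin n) → δ i i ≡ 1ℚ
δ-refl i = cong toℚ (dec-true (i ≟F i) refl)

δ-≢ : ∀ {n} {i j : Fin n} → i ≢ j → δ i j ≡ 0ℚ
δ-≢ i≢j = cong toℚ (dec-false (_ ≟F _) i≢j)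

Σ-δ : ∀ n (i : Fin n) (f : Fin n → ℚ) → Σℚ n (λ j → δ i j * f j) ≡ f i
Σ-δ (suc n) fzero f = trans
  (cong₂ _+_ (*-identityˡ (f fzero)) (Σ-zero n λ j → *-zeroˡ (f (fsuc j))))
  (+-identityʳ (f fzero))
Σ-δ (suc n) (fsuc i) f = trans
  (cong₂ _+_ (*-zeroˡ (f fzero)) (Σ-δ n i (λ j → f (fsuc j))))
  (+-identityˡ (f (fsuc i)))

δ-sym : ∀ {n} (i j : Fin n) → δ i j ≡ δ j i
δ-sym i j with i ≟F j
... | yes refl = sym (δ-refl i)
... | no i≢j = sym (δ-≢ (λ j≡i → i≢j (sym j≡i)))

identity-δ : ∀ {n} (i j : Fin n) → identity n i j ≡ δ i j
identity-δ i j with i ≟F j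
... | yes _ = refl
... | no _ = refl

Vector : ℕ → Set
Vector n = Fin n → ℚ

infixr 8 _∗_
_∗_ : ∀ {m n} → Mat m n → Vector n → Vector m
_∗_ {n = n} M x i = Σℚ n (λ j → M i j * x j)

dot : ∀ {n} → Vector n → Vector n → ℚ
dot {n} x y = Σℚ n (λ i → x i * y i)

column : ∀ {m n} → Mat m n → Fin n → Vector m
column M j i = M i j

∗-cong : ∀ {m n} (M : Mat m n) {x y : Vector n} → (∀ j → x j ≡ y j) → ∀ i → (M ∗ x) i ≡ (M ∗ y) i
∗-cong {n = n} M eq i = Σ-cong n λ j → cong (M i j *_) (eq j)

∗-scale : ∀ {m n} (M : Mat m n) t (x : Vector n) i → (M ∗ (λ j → t * x j)) i ≡ t * (M ∗ x) i
∗-scale {n = n} M t x i = trans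
  (Σ-cong n λ j → solve 3 (λ a b c → a :* (b :* c) := b :* (a :* c)) refl (M i j) t (x j))
  (sym (*-distribˡ-Σ n t _))

∗-zero : ∀ {m n} (M : Mat m n) {x : Vector n} → (∀ j → x j ≡ 0ℚ) → ∀ i → (M ∗ x) i ≡ 0ℚ
∗-zero {n = n} M eq i = Σ-zero n λ j → trans (cong (M i j *_) (eq j)) (*-zeroʳ (M i j))

∗-assoc : ∀ {l m n} (M : Mat l m) (N : Mat m n) (x : Vector n) i → (M ∗ N ∗ x) i ≡ ((M · N) ∗ x) i
∗-assoc {m = m} {n} M N x i = begin
  Σℚ m (λ j → M i j * Σℚ n (λ k → N j k * x k))
    ≡⟨ Σ-cong m (λ j → *-distribˡ-Σ n (M i j) _) ⟩
  Σℚ m (λ j → Σℚ n (λ k → M i j * (N j k * x k)))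
    ≡⟨ Σ-swap m n _ ⟩
  Σℚ n (λ k → Σℚ m (λ j → M i j * (N j k * x k)))
    ≡⟨ Σ-cong n (λ k → Σ-cong m λ j → sym (*-assoc (M i j) (N j k) (x k))) ⟩
  Σℚ n (λ k → Σℚ m (λ j → M i j * N j k * x k))
    ≡⟨ Σ-cong n (λ k → sym (*-distribʳ-Σ m (x k) _)) ⟩
  Σℚ n (λ k → (M · N) i k * x k)
    ∎

dot-comm : ∀ {n} (x y : Vector n) → dot x y ≡ dot y x
dot-comm {n} x y = Σ-cong n λ i → *-comm (x i) (y i)

dot-adjoint : ∀ {m n} (M : Mat m n) x y → dot (M ∗ x) y ≡ dot x (transpose M ∗ y)
dot-adjoint {m} {n} M x y = begin
  Σℚ m (λ i → (M ∗ x) i * y i)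
    ≡⟨ Σ-cong m (λ i → *-distribʳ-Σ n (y i) _) ⟩
  Σℚ m (λ i → Σℚ n (λ j → M i j * x j * y i))
    ≡⟨ Σ-swap m n _ ⟩
  Σℚ n (λ j → Σℚ m (λ i → M i j * x j * y i))
    ≡⟨ Σ-cong n (λ j → Σ-cong m λ i →
         solve 3 (λ a b c → a :* b :* c := b :* (a :* c)) refl (M i j) (x j) (y i)) ⟩
  Σℚ n (λ j → Σℚ m (λ i → x j * (M i j * y i)))
    ≡⟨ Σ-cong n (λ j → sym (*-distribˡ-Σ m (x j) _)) ⟩
  dot x (transpose M ∗ y)
    ∎

identity-∗ : ∀ {n} {I : Mat n n} → (∀ i j → I i j ≡ identity n i j) → ∀ x i → (I ∗ x) i ≡ x i
identity-∗ {n} I≡1 x i =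
  trans (Σ-cong n λ j → cong (_* x j) (trans (I≡1 i j) (identity-δ i j))) (Σ-δ n i x)

leftInverse-∗ : ∀ {n} {Q P : Mat n n} → (∀ i j → (Q · P) i j ≡ identity n i j) → ∀ x i → (Q ∗ P ∗ x) i ≡ x i
leftInverse-∗ {Q = Q} {P} QP x i = trans (∗-assoc Q P x i) (identity-∗ QP x i)

*-cancelˡ-0 : ∀ {p q} → p ≢ 0ℚ → p * q ≡ 0ℚ → q ≡ 0ℚ
*-cancelˡ-0 {p} {q} p≢0 eq = begin
  q              ≡⟨ sym (*-identityˡ q) ⟩
  1ℚ * q         ≡⟨ cong (_* q) (sym (*-inverseˡ p)) ⟩
  1/ p * p * q   ≡⟨ *-assoc (1/ p) p q ⟩
  1/ p * (p * q) ≡⟨ cong (1/ p *_) eq ⟩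
  1/ p * 0ℚ      ≡⟨ *-zeroʳ (1/ p) ⟩
  0ℚ             ∎
  where instance _ = ≢-nonZero p≢0

-- Gaussian elimination on the first column.
underdetermined : ∀ m (M : Mat m (suc m)) → ∃ λ x → (∃ λ j → x j ≢ 0ℚ) × (∀ i → (M ∗ x) i ≡ 0ℚ)
underdetermined m M with any? (λ r → ¬? (M r fzero ≟ 0ℚ))
... | no noPivot = δ fzero , (fzero , λ ()) , λ i → begin
  (M ∗ δ fzero) i
    ≡⟨ Σ-cong (suc m) {λ j → M i j * δ fzero j} {λ j → δ fzero j * M i j} (λ j → *-comm (M i j) (δ fzero j)) ⟩
  Σℚ (suc m) (λ j → δ fzero j * M i j)
    ≡⟨ Σ-δ (suc m) fzero (M i) ⟩
  M i fzero
    ≡⟨ decidable-stable (M i fzero ≟ 0ℚ) (λ Mi≢0 → noPivot (i , Mi≢0)) ⟩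
  0ℚ
    ∎
underdetermined (suc m) M | yes (r , Mr≢0) = x , (fsuc j , x'j≢0) , Mx≡0
  where
  instance _ = ≢-nonZero Mr≢0
  M⁺ : Mat (suc m) (suc m)
  M⁺ i k = M i (fsuc k)
  a : ℚ
  a = 1/ (M r fzero)
  c : Fin (suc m) → ℚ
  c i = - (M i fzero * a)
  N : Mat (suc m) (suc m)
  N i k = M⁺ i k + c i * M⁺ r k
  -- The pivot row of `N` is zero; dropping it leaves one row and one column fewer.
  rec = underdetermined m (λ i → N (punchIn r i))
  x' = proj₁ rec
  j = proj₁ (proj₁ (proj₂ rec))
  x'j≢0 = proj₂ (proj₁ (proj₂ rec))
  s : ℚ
  s = dot (M⁺ r) x'
  x : Vector (suc (suc m))
  -- The value that the equation of the pivot row forces.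
  x fzero    = - (a * s)
  x (fsuc k) = x' k
  combine : ∀ i → dot (M⁺ i) x' + c i * dot (M⁺ r) x' ≡ (N ∗ x') i
  combine i = trans (cong (dot (M⁺ i) x' +_) (*-distribˡ-Σ (suc m) (c i) (λ k → M⁺ r k * x' k)))
    (trans (sym (Σ-distrib-+ (suc m) (λ k → M⁺ i k * x' k) (λ k → c i * (M⁺ r k * x' k))))
      (Σ-cong (suc m) {λ k → M⁺ i k * x' k + c i * (M⁺ r k * x' k)} {λ k → N i k * x' k}
        λ k → solve 4 (λ u c v y → u :* y :+ c :* (v :* y) := (u :+ c :* v) :* y) refl
                (M⁺ i k) (c i) (M⁺ r k) (x' k)))
  Mx≡0 : ∀ i → (M ∗ x) i ≡ 0ℚ
  Mx≡0 i with r ≟F i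
  ... | yes refl = begin
    M r fzero * - (a * s) + s ≡⟨ solve 3 (λ p a s → p :* (:- (a :* s)) :+ s := s :+ :- (p :* a :* s)) refl (M r fzero) a s ⟩
    s - M r fzero * a * s     ≡⟨ cong (λ q → s - q * s) (*-inverseʳ (M r fzero)) ⟩
    s - 1ℚ * s                ≡⟨ solve 1 (λ s → s :+ :- (con 1ℚ :* s) := con 0ℚ) refl s ⟩
    0ℚ                        ∎
  ... | no r≢i = begin
    M i fzero * - (a * s) + dot (M⁺ i) x'
      ≡⟨ solve 4 (λ p a s d → p :* (:- (a :* s)) :+ d := d :+ :- (p :* a) :* s) refl (M i fzero) a s (dot (M⁺ i) x') ⟩
    dot (M⁺ i) x' + c i * s
      ≡⟨ combine i ⟩
    (N ∗ x') i
      ≡⟨ cong (N ∗ x') (sym (punchIn-punchOut r≢i)) ⟩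
    (N ∗ x') (punchIn r (punchOut r≢i))
      ≡⟨ proj₂ (proj₂ rec) (punchOut r≢i) ⟩
    0ℚ
      ∎

TrivialKernel : ∀ {m n} → Mat m n → Set
TrivialKernel M = ∀ x → (∀ i → (M ∗ x) i ≡ 0ℚ) → ∀ j → x j ≡ 0ℚ

-- A nonzero null vector of the augmented matrix has a nonzero coefficient at `b`: otherwise its
-- other entries would form a kernel vector of `M` and vanish too. Dividing by that coefficient
-- solves the system.
solvable : ∀ {n} (M : Mat n n) → TrivialKernel M → (b : Vector n) → Σ (Vector n) λ x → ∀ i → (M ∗ x) i ≡ b i
solvable {n} M M-inj b = x , Mx≡b
  where
  M∣b : Mat n (suc n)
  M∣b i fzero    = b i
  M∣b i (fsuc j) = M i j
  rec = underdetermined n M∣b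
  z : Vector (suc n)
  z = proj₁ rec
  z₀ : ℚ
  z₀ = z fzero
  y : Vector n
  y j = z (fsuc j)
  z₀≢0 : z₀ ≢ 0ℚ
  z₀≢0 z₀≡0 = allZero (proj₁ (proj₁ (proj₂ rec))) (proj₂ (proj₁ (proj₂ rec)))
    where
    My≡0 : ∀ i → (M ∗ y) i ≡ 0ℚ
    My≡0 i = begin
      (M ∗ y) i                   ≡⟨ solve 2 (λ b s → s := b :* con 0ℚ :+ s) refl (b i) ((M ∗ y) i) ⟩
      b i * 0ℚ + (M ∗ y) i        ≡⟨ cong (λ t → b i * t + (M ∗ y) i) (sym z₀≡0) ⟩
      b i * z₀ + (M ∗ y) i        ≡⟨ proj₂ (proj₂ rec) i ⟩
      0ℚ                          ∎
    allZero : ∀ j → ¬ (z j ≢ 0ℚ)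
    allZero fzero    z≢0 = z≢0 z₀≡0
    allZero (fsuc j) z≢0 = z≢0 (M-inj y My≡0 j)
  instance _ = ≢-nonZero z₀≢0
  a : ℚ
  a = 1/ z₀
  x : Vector n
  x j = - a * y j
  Mx≡b : ∀ i → (M ∗ x) i ≡ b i
  Mx≡b i = begin
    (M ∗ x) i                               ≡⟨ ∗-scale M (- a) y i ⟩
    - a * s                                 ≡⟨ solve 4 (λ a b z s → :- a :* s := a :* z :* b :+ :- (a :* (b :* z :+ s))) refl a (b i) z₀ s ⟩
    a * z₀ * b i - a * (b i * z₀ + s)       ≡⟨ cong₂ (λ p q → p * b i - a * q) (*-inverseˡ z₀) (proj₂ (proj₂ rec) i) ⟩
    1ℚ * b i - a * 0ℚ                       ≡⟨ solve 2 (λ a b → con 1ℚ :* b :+ :- (a :* con 0ℚ) := b) refl a (b i) ⟩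
    b i                                     ∎
    where
    s : ℚ
    s = (M ∗ y) i

rightInverse : ∀ {n} (M : Mat n n) → TrivialKernel M → Σ (Mat n n) λ N → ∀ i j → (M · N) i j ≡ identity n i j
rightInverse M M-inj =
  (λ i j → proj₁ (sol j) i) , λ i j → trans (proj₂ (sol j) i) (sym (identity-δ i j))
  where
  sol = λ j → solvable M M-inj (λ i → δ i j)

rightInverse-trivialKernel : ∀ {n} {M N : Mat n n} → (∀ i j → (M · N) i j ≡ identity n i j) → TrivialKernel N
rightInverse-trivialKernel {M = M} {N} MN x Nx≡0 j =
  trans (sym (leftInverse-∗ {Q = M} {N} MN x j)) (∗-zero M Nx≡0 j)

-- A right inverse `N` of `M` has trivial kernel, hence a right inverse `K` of its own. Then K = M N
-- K = M, so `N` is inverse to `M` on both sides.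
inverse : ∀ {n} (M : Mat n n) → TrivialKernel M →
  Σ (Mat n n) λ N → (∀ i j → (N · M) i j ≡ identity n i j) × (∀ i j → (M · N) i j ≡ identity n i j)
inverse {n} M M-inj = N , NM , MN
  where
  N = proj₁ (rightInverse M M-inj)
  MN = proj₂ (rightInverse M M-inj)
  K,NK = rightInverse N (rightInverse-trivialKernel {M = M} {N} MN)
  K = proj₁ K,NK
  K≡M : ∀ i j → K i j ≡ M i j
  K≡M i j = begin
    K i j                  ≡⟨ sym (leftInverse-∗ {Q = M} {N} MN (column K j) i) ⟩
    (M ∗ N ∗ column K j) i ≡⟨ ∗-cong M (λ l → trans (proj₂ K,NK l j) (identity-δ l j)) i ⟩
    (M ∗ (λ l → δ l j)) i  ≡⟨ Σ-cong n (λ l → trans (*-comm (M i l) (δ l j)) (cong (_* M i l) (δ-sym l j))) ⟩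
    Σℚ n (λ l → δ j l * M i l) ≡⟨ Σ-δ n j (M i) ⟩
    M i j                  ∎
  NM : ∀ i j → (N · M) i j ≡ identity n i j
  NM i j = trans (∗-cong N (λ l → sym (K≡M l j)) i) (proj₂ K,NK i j)

-- Counting inside ℚ

natℚ : ℕ → ℚ
natℚ m = (ℤ.+ m) / 1

-- Since `_/_` reduces to lowest terms, the two sides are compared as unnormalised fractions with
-- denominator 1.
natℚ-+ : ∀ m n → natℚ (m ℕ.+ n) ≡ natℚ m + natℚ n
natℚ-+ m n = trans
  (fromℚᵘ-cong {mkℚᵘ (ℤ.+ (m ℕ.+ n)) 0} {mkℚᵘ (ℤ.+ m) 0 ℚᵘ.+ mkℚᵘ (ℤ.+ n) 0}
    (*≡* (cong (ℤ._* (ℤ.+ 1)) (trans (ℤ.pos-+ m n)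
      (sym (cong₂ ℤ._+_ (ℤ.*-identityʳ (ℤ.+ m)) (ℤ.*-identityʳ (ℤ.+ n))))))))
  (toℚᵘ-injective (ℚᵘ.≃-trans (toℚᵘ-fromℚᵘ (mkℚᵘ (ℤ.+ m) 0 ℚᵘ.+ mkℚᵘ (ℤ.+ n) 0))
    (ℚᵘ.≃-sym (ℚᵘ.≃-trans (toℚᵘ-homo-+ (natℚ m) (natℚ n))
      (ℚᵘ.+-cong (toℚᵘ-fromℚᵘ (mkℚᵘ (ℤ.+ m) 0)) (toℚᵘ-fromℚᵘ (mkℚᵘ (ℤ.+ n) 0)))))))

natℚ-injective : ∀ {m n} → natℚ m ≡ natℚ n → m ≡ n
natℚ-injective {m} {n} eq with fromℚᵘ-injective {mkℚᵘ (ℤ.+ m) 0} {mkℚᵘ (ℤ.+ n) 0} eq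
... | *≡* m1≡n1 = ℤ.+-injective (trans (sym (ℤ.*-identityʳ (ℤ.+ m))) (trans m1≡n1 (ℤ.*-identityʳ (ℤ.+ n))))

count-Σ : ∀ n (b : Fin n → Bool) → natℚ (count n b) ≡ Σℚ n (λ i → toℚ (b i))
count-Σ zero b = refl
count-Σ (suc n) b with b fzero | count-Σ n (λ i → b (fsuc i))
... | true  | ih = trans (natℚ-+ 1 (count n λ i → b (fsuc i))) (cong (1ℚ +_) ih)
... | false | ih = trans ih (sym (+-identityˡ (Σℚ n λ i → toℚ (b (fsuc i)))))

count-split : ∀ n (b d : Fin n → Bool) →
  count n b ≡ count n (λ i → b i ∧ d i) ℕ.+ count n (λ i → b i ∧ not (d i))
count-split zero b d = refl
count-split (suc n) b d with b fzero | d fzero | count-split n (λ i → b (fsuc i)) (λ i → d (fsuc i))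
... | true  | true  | ih = cong suc ih
... | true  | false | ih = trans (cong suc ih) (sym (ℕ.+-suc _ _))
... | false | true  | ih = ih
... | false | false | ih = ih

count-cong : ∀ n {b d : Fin n → Bool} → (∀ i → b i ≡ d i) → count n b ≡ count n d
count-cong zero eq = refl
count-cong (suc n) eq = cong₂ (λ b k → (if b then 1 else 0) ℕ.+ k) (eq fzero) (count-cong n (λ i → eq (fsuc i)))

count-true : ∀ n → count n (λ _ → true) ≡ n
count-true zero = refl
count-true (suc n) = cong suc (count-true n)

Σ-one : ∀ n → Σℚ n (λ _ → 1ℚ) ≡ natℚ n
Σ-one n = trans (sym (count-Σ n (λ _ → true))) (cong natℚ (count-true n))

-- Laplacians and eigenbases

Σ-nonNeg : ∀ n {f : Fin n → ℚ} → (∀ i → 0ℚ ≤ f i) → 0ℚ ≤ Σℚ n f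
Σ-nonNeg zero    f≥0 = ≤-refl
Σ-nonNeg (suc n) f≥0 = +-mono-≤ (f≥0 fzero) (Σ-nonNeg n λ i → f≥0 (fsuc i))

term≤Σ : ∀ n {f : Fin n → ℚ} → (∀ i → 0ℚ ≤ f i) → ∀ i → f i ≤ Σℚ n f
term≤Σ (suc n) {f} f≥0 fzero = subst (_≤ Σℚ (suc n) f) (+-identityʳ (f fzero))
  (+-monoʳ-≤ (f fzero) (Σ-nonNeg n λ i → f≥0 (fsuc i)))
term≤Σ (suc n) {f} f≥0 (fsuc i) = subst (_≤ Σℚ (suc n) f) (+-identityˡ (f (fsuc i)))
  (+-mono-≤ (f≥0 fzero) (term≤Σ n (λ i → f≥0 (fsuc i)) i))

Σ-nonNeg-zero : ∀ n {f : Fin n → ℚ} → (∀ i → 0ℚ ≤ f i) → Σℚ n f ≡ 0ℚ → ∀ i → f i ≡ 0ℚ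
Σ-nonNeg-zero n {f} f≥0 eq i = ≤-antisym (subst (f i ≤_) eq (term≤Σ n f≥0 i)) (f≥0 i)

square-nonNeg : ∀ p → 0ℚ ≤ p * p
square-nonNeg p with ≤-total 0ℚ p
... | inj₁ 0≤p = nonNegative⁻¹ (p * p) {{nonNeg*nonNeg⇒nonNeg p {{nonNegative 0≤p}} p {{nonNegative 0≤p}}}}
... | inj₂ p≤0 = nonNegative⁻¹ (p * p) {{nonPos*nonPos⇒nonPos p {{nonPositive p≤0}} p {{nonPositive p≤0}}}}

square-zero : ∀ {p} → p * p ≡ 0ℚ → p ≡ 0ℚ
square-zero {p} eq = decidable-stable (p ≟ 0ℚ) λ p≢0 → p≢0 (*-cancelˡ-0 p≢0 eq)

difference-zero : ∀ {p q} → p - q ≡ 0ℚ → p ≡ q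
difference-zero {p} {q} eq = begin
  p           ≡⟨ solve 2 (λ p q → p := (p :+ :- q) :+ q) refl p q ⟩
  p - q + q   ≡⟨ cong (_+ q) eq ⟩
  0ℚ + q      ≡⟨ +-identityˡ q ⟩
  q           ∎

Symmetric : ∀ {n} → Adj n → Set
Symmetric b = ∀ u v → b u v ≡ b v u

complement-symmetric : ∀ {n} {a : Adj n} → Symmetric a → Symmetric (complement a)
complement-symmetric {a = a} a-sym u v = go (u ≟F v)
  where
  go : Dec (u ≡ v) → complement a u v ≡ complement a v u
  go (yes refl) = refl
  go (no u≢v)
    rewrite dec-false (u ≟F v) u≢v | dec-false (v ≟F u) (λ v≡u → u≢v (sym v≡u)) = cong not (a-sym u v)

laplacian-δ : ∀ {n} (b : Adj n) u v → laplacian b u v ≡ δ u v * degree b u - toℚ (b u v)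
laplacian-δ b u v with u ≟F v
... | yes _ = cong (_- toℚ (b u v)) (sym (*-identityˡ (degree b u)))
... | no _  = cong (_- toℚ (b u v)) (sym (*-zeroˡ (degree b u)))

-- The degree is a row sum of the adjacency matrix, so the diagonal term spreads over the
-- neighbours. In this form vectors constant along edges visibly lie in the kernel, and a graph and
-- its complement add up term by term.
laplacian-∗ : ∀ {n} (b : Adj n) x u →
  (laplacian b ∗ x) u ≡ Σℚ n (λ v → toℚ (b u v) * (x u - x v))
laplacian-∗ {n} b x u = begin
  (laplacian b ∗ x) u
    ≡⟨ Σ-cong n (λ v → trans (cong (_* x v) (laplacian-δ b u v))
         (solve 4 (λ d e w y → (d :* e :+ :- w) :* y := d :* (e :* y) :+ w :* (:- y)) refl
           (δ u v) (degree b u) (toℚ (b u v)) (x v))) ⟩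
  Σℚ n (λ v → δ u v * (degree b u * x v) + toℚ (b u v) * - x v)
    ≡⟨ Σ-distrib-+ n _ _ ⟩
  Σℚ n (λ v → δ u v * (degree b u * x v)) + Σℚ n (λ v → toℚ (b u v) * - x v)
    ≡⟨ cong (_+ Σℚ n (λ v → toℚ (b u v) * - x v))
         (trans (Σ-δ n u (λ v → degree b u * x v)) (*-distribʳ-Σ n (x u) _)) ⟩
  Σℚ n (λ v → toℚ (b u v) * x u) + Σℚ n (λ v → toℚ (b u v) * - x v)
    ≡⟨ sym (Σ-distrib-+ n _ _) ⟩
  Σℚ n (λ v → toℚ (b u v) * x u + toℚ (b u v) * - x v)
    ≡⟨ Σ-cong n (λ v → sym (*-distribˡ-+ (toℚ (b u v)) (x u) (- x v))) ⟩
  Σℚ n (λ v → toℚ (b u v) * (x u - x v))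
    ∎

laplacian-symmetric : ∀ {n} {b : Adj n} → Symmetric b → ∀ u v → laplacian b u v ≡ laplacian b v u
laplacian-symmetric {b = b} b-sym u v = go (u ≟F v)
  where
  go : Dec (u ≡ v) → laplacian b u v ≡ laplacian b v u
  go (yes refl) = refl
  go (no u≢v) = begin
    laplacian b u v                       ≡⟨ laplacian-δ b u v ⟩
    δ u v * degree b u - toℚ (b u v)      ≡⟨ cong₂ (λ d w → d * degree b u - toℚ w) (δ-≢ u≢v) (b-sym u v) ⟩
    0ℚ * degree b u - toℚ (b v u)         ≡⟨ cong (_- toℚ (b v u)) (trans (*-zeroˡ (degree b u)) (sym (*-zeroˡ (degree b v)))) ⟩
    0ℚ * degree b v - toℚ (b v u)         ≡⟨ cong (λ d → d * degree b v - toℚ (b v u)) (sym (δ-≢ λ v≡u → u≢v (sym v≡u))) ⟩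
    δ v u * degree b v - toℚ (b v u)      ≡⟨ sym (laplacian-δ b v u) ⟩
    laplacian b v u                       ∎

laplacian-selfAdjoint : ∀ {n} {b : Adj n} → Symmetric b → ∀ x y →
  dot (laplacian b ∗ x) y ≡ dot x (laplacian b ∗ y)
laplacian-selfAdjoint {n} {b} b-sym x y = trans (dot-adjoint (laplacian b) x y)
  (Σ-cong n λ u → cong (x u *_) (Σ-cong n λ v → cong (_* y v) (laplacian-symmetric {b = b} b-sym v u)))

Kernel : ∀ {m n} → Mat m n → Vector n → Set
Kernel M x = ∀ i → (M ∗ x) i ≡ 0ℚ

-- Twice the quadratic form x ⋅ Lx is the sum of b u v (x u - x v)².
kernel-adjacent : ∀ {n} {b : Adj n} → Symmetric b → ∀ {x} → Kernel (laplacian b) x →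
  ∀ {u v} → b u v ≡ true → x u ≡ x v
kernel-adjacent {n} {b} b-sym {x} Lx≡0 {u} {v} buv = difference-zero (square-zero (begin
  (x u - x v) * (x u - x v)   ≡⟨ sym (*-identityˡ ((x u - x v) * (x u - x v))) ⟩
  toℚ true * ((x u - x v) * (x u - x v)) ≡⟨ cong (λ t → toℚ t * ((x u - x v) * (x u - x v))) (sym buv) ⟩
  q u v                       ≡⟨ Σ-nonNeg-zero n (q-nonNeg u) (Σ-nonNeg-zero n (λ u → Σ-nonNeg n (q-nonNeg u)) Σq≡0 u) v ⟩
  0ℚ                          ∎))
  where
  q r : Fin n → Fin n → ℚ
  q u v = toℚ (b u v) * ((x u - x v) * (x u - x v))
  r u v = x u * (toℚ (b u v) * (x u - x v))
  q-nonNeg : ∀ u v → 0ℚ ≤ q u v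
  q-nonNeg u v with b u v
  ... | true  = subst (0ℚ ≤_) (sym (*-identityˡ ((x u - x v) * (x u - x v)))) (square-nonNeg (x u - x v))
  ... | false = ≤-reflexive (sym (*-zeroˡ ((x u - x v) * (x u - x v))))
  Σr≡0 : ∀ u → Σℚ n (r u) ≡ 0ℚ
  Σr≡0 u = begin
    Σℚ n (r u)                                    ≡⟨ sym (*-distribˡ-Σ n (x u) _) ⟩
    x u * Σℚ n (λ v → toℚ (b u v) * (x u - x v))  ≡⟨ cong (x u *_) (trans (sym (laplacian-∗ b x u)) (Lx≡0 u)) ⟩
    x u * 0ℚ                                      ≡⟨ *-zeroʳ (x u) ⟩
    0ℚ                                            ∎
  q-split : ∀ u v → q u v ≡ r u v + r v u
  q-split u v = trans
    (solve 3 (λ w p s → w :* ((p :+ :- s) :* (p :+ :- s))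
        := p :* (w :* (p :+ :- s)) :+ s :* (w :* (s :+ :- p))) refl (toℚ (b u v)) (x u) (x v))
    (cong (λ w → r u v + x v * (toℚ w * (x v - x u))) (b-sym u v))
  Σq≡0 : Σℚ n (λ u → Σℚ n (q u)) ≡ 0ℚ
  Σq≡0 = begin
    Σℚ n (λ u → Σℚ n (q u))
      ≡⟨ Σ-cong n (λ u → trans (Σ-cong n (q-split u)) (Σ-distrib-+ n _ _)) ⟩
    Σℚ n (λ u → Σℚ n (r u) + Σℚ n (λ v → r v u))
      ≡⟨ Σ-distrib-+ n _ _ ⟩
    Σℚ n (λ u → Σℚ n (r u)) + Σℚ n (λ u → Σℚ n (λ v → r v u))
      ≡⟨ cong₂ _+_ (Σ-zero n Σr≡0) (trans (Σ-swap n n (λ u v → r v u)) (Σ-zero n Σr≡0)) ⟩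
    0ℚ + 0ℚ
      ≡⟨ +-identityʳ 0ℚ ⟩
    0ℚ
      ∎

kernel-reachable : ∀ {n} {b : Adj n} → Symmetric b → ∀ {x} → Kernel (laplacian b) x →
  ∀ {u v} → Reachable b u v → x u ≡ x v
kernel-reachable b-sym Lx≡0 here = refl
kernel-reachable b-sym Lx≡0 (step buv v⇝w) =
  trans (kernel-adjacent b-sym Lx≡0 buv) (kernel-reachable b-sym Lx≡0 v⇝w)

adjacent-kernel : ∀ {n} (b : Adj n) {x} → (∀ {u v} → b u v ≡ true → x u ≡ x v) → Kernel (laplacian b) x
adjacent-kernel {n} b {x} x-const u = trans (laplacian-∗ b x u) (Σ-zero n vanish)
  where
  vanish : ∀ v → toℚ (b u v) * (x u - x v) ≡ 0ℚ
  vanish v with b u v in buv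
  ... | false = *-zeroˡ (x u - x v)
  ... | true  = trans (cong (λ y → 1ℚ * (y - x v)) (x-const buv))
    (solve 1 (λ y → con 1ℚ :* (y :+ :- y) := con 0ℚ) refl (x v))

laplacian-complement : ∀ {n} (a : Adj n) x u →
  (laplacian a ∗ x) u + (laplacian (complement a) ∗ x) u ≡ Σℚ n (λ v → x u - x v)
laplacian-complement {n} a x u = begin
  (laplacian a ∗ x) u + (laplacian (complement a) ∗ x) u
    ≡⟨ cong₂ _+_ (laplacian-∗ a x u) (laplacian-∗ (complement a) x u) ⟩
  Σℚ n (λ v → toℚ (a u v) * (x u - x v)) + Σℚ n (λ v → toℚ (complement a u v) * (x u - x v))
    ≡⟨ sym (Σ-distrib-+ n _ _) ⟩
  Σℚ n (λ v → toℚ (a u v) * (x u - x v) + toℚ (complement a u v) * (x u - x v))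
    ≡⟨ Σ-cong n pair ⟩
  Σℚ n (λ v → x u - x v)
    ∎
  where
  pair : ∀ v → toℚ (a u v) * (x u - x v) + toℚ (complement a u v) * (x u - x v) ≡ x u - x v
  pair v with u ≟F v
  ... | yes refl = solve 2 (λ w y → w :* (y :+ :- y) :+ con 0ℚ :* (y :+ :- y) := y :+ :- y) refl (toℚ (a u u)) (x u)
  ... | no _ with a u v
  ...   | true  = solve 1 (λ d → con 1ℚ :* d :+ con 0ℚ :* d := d) refl (x u - x v)
  ...   | false = solve 1 (λ d → con 0ℚ :* d :+ con 1ℚ :* d := d) refl (x u - x v)

Constant : ∀ {n} → Vector n → Set
Constant x = ∀ u v → x u ≡ x v

-- Connectedness in spectral form, the only form in which it is used; no path in the complement has
-- to be built.
Connected : ∀ {n} → Adj n → Set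
Connected b = ∀ x → Kernel (laplacian b) x → Constant x

-- Vertices in different components of `a` are adjacent in the complement; vertices in the same
-- component have a common neighbour there, namely any vertex of another component.
complement-connected : ∀ {n q} {a : Adj n} → Symmetric a → {c : Fin n → Fin (suc (suc q))} →
  IsComponentLabelling a c → Connected (complement a)
complement-connected {n} {q} {a} a-sym {c} (c-onto , c-reach) x Lx≡0 = const
  where
  across : ∀ u v → c u ≢ c v → x u ≡ x v
  across u v cu≢cv = kernel-adjacent {b = complement a} (complement-symmetric {a = a} a-sym) Lx≡0 nonadjacent
    where
    nonadjacent : complement a u v ≡ true
    nonadjacent with u ≟F v
    ... | yes refl = contradiction refl cu≢cv
    ... | no _ with a u v in auv
    ...   | false = refl
    ...   | true  = contradiction (Equivalence.from (c-reach u v) (step auv here)) cu≢cv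
  other : ∀ (k : Fin (suc (suc q))) → ∃ λ l → k ≢ l
  other fzero    = fsuc fzero , λ ()
  other (fsuc _) = fzero , λ ()
  const : Constant x
  const u v with c u ≟F c v
  ... | no cu≢cv = across u v cu≢cv
  ... | yes cu≡cv with other (c u)
  ...   | l , cu≢l with c-onto l
  ...     | w , refl = trans (across u w cu≢l) (across w v λ cw≡cv → cu≢l (trans cu≡cv (sym cw≡cv)))

-- Orthogonality and completeness of eigenbases

record Eigenbasis {n : ℕ} (b : Adj n) (P : Mat n n) : Set where
  field
    inv        : Mat n n
    inv-left   : ∀ i j → (inv · P) i j ≡ identity n i j
    inv-right  : ∀ i j → (P · inv) i j ≡ identity n i j
    eigenvalue : Vector n
    eigen      : ∀ j u → (laplacian b ∗ column P j) u ≡ eigenvalue j * P u j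

-- With `Q` inverse to `P` and D = Q L P, column j of L P equals P applied to column j of D, which
-- has a single entry, on the diagonal.
diagonalizes⇒eigenbasis : ∀ {n} (b : Adj n) {P : Mat n n} → Diagonalizes b P → Eigenbasis b P
diagonalizes⇒eigenbasis {n} b {P} (Q , QP , PQ , D-diag) = record
  { inv = Q ; inv-left = QP ; inv-right = PQ ; eigenvalue = λ j → D j j ; eigen = eigen }
  where
  L = laplacian b
  D = (Q · L) · P
  D-column : ∀ u j i → P u i * D i j ≡ δ j i * (D j j * P u i)
  D-column u j i = go (j ≟F i)
    where
    go : Dec (j ≡ i) → P u i * D i j ≡ δ j i * (D j j * P u i)
    go (yes refl) = trans (*-comm (P u j) (D j j))
      (trans (sym (*-identityˡ (D j j * P u j))) (cong (_* (D j j * P u j)) (sym (δ-refl j))))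
    go (no j≢i) = trans (trans (cong (P u i *_) (D-diag i j λ i≡j → j≢i (sym i≡j))) (*-zeroʳ (P u i)))
      (sym (trans (cong (_* (D j j * P u i)) (δ-≢ j≢i)) (*-zeroˡ (D j j * P u i))))
  eigen : ∀ j u → (L ∗ column P j) u ≡ D j j * P u j
  eigen j u = begin
    (L ∗ column P j) u          ≡⟨ sym (leftInverse-∗ {Q = P} {Q} PQ (L ∗ column P j) u) ⟩
    (P ∗ Q ∗ L ∗ column P j) u  ≡⟨ ∗-cong P (∗-assoc Q L (column P j)) u ⟩
    (P ∗ column D j) u          ≡⟨ Σ-cong n (D-column u j) ⟩
    Σℚ n (λ i → δ j i * (D j j * P u i)) ≡⟨ Σ-δ n j (λ i → D j j * P u i) ⟩
    D j j * P u j               ∎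

eigenbasis⇒diagonalizes : ∀ {n} {b : Adj n} {P : Mat n n} → Eigenbasis b P → Diagonalizes b P
eigenbasis⇒diagonalizes {n} {b} {P} E = Q , E.inv-left , E.inv-right , diag
  where
  module E = Eigenbasis E
  Q = E.inv
  L = laplacian b
  diag : IsDiagonal ((Q · L) · P)
  diag i j i≢j = begin
    ((Q · L) · P) i j                              ≡⟨ sym (∗-assoc Q L (column P j) i) ⟩
    (Q ∗ L ∗ column P j) i                         ≡⟨ ∗-cong Q (E.eigen j) i ⟩
    (Q ∗ (λ u → E.eigenvalue j * P u j)) i         ≡⟨ ∗-scale Q (E.eigenvalue j) (column P j) i ⟩
    E.eigenvalue j * (Q · P) i j                   ≡⟨ cong (E.eigenvalue j *_) (trans (E.inv-left i j) (trans (identity-δ i j) (δ-≢ i≢j))) ⟩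
    E.eigenvalue j * 0ℚ                            ≡⟨ *-zeroʳ (E.eigenvalue j) ⟩
    0ℚ                                             ∎

-- The kernel of the transpose consists of the vectors orthogonal to all columns of `M`, which makes
-- this the convenient criterion for a matrix given by its columns.
inverse-transpose : ∀ {n} (M : Mat n n) → TrivialKernel (transpose M) →
  Σ (Mat n n) λ N → (∀ i j → (N · M) i j ≡ identity n i j) × (∀ i j → (M · N) i j ≡ identity n i j)
inverse-transpose {n} M Mᵀ-inj = transpose N , NᵀM , MNᵀ
  where
  rec = inverse (transpose M) Mᵀ-inj
  N : Mat n n
  N = proj₁ rec
  swap-identity : ∀ i j → identity n j i ≡ identity n i j
  swap-identity i j = trans (identity-δ j i) (trans (δ-sym j i) (sym (identity-δ i j)))
  NᵀM : ∀ i j → (transpose N · M) i j ≡ identity n i j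
  NᵀM i j = trans (dot-comm (column N i) (column M j)) (trans (proj₂ (proj₂ rec) j i) (swap-identity i j))
  MNᵀ : ∀ i j → (M · transpose N) i j ≡ identity n i j
  MNᵀ i j = trans (dot-comm (M i) (N j)) (trans (proj₁ (proj₂ rec) j i) (swap-identity i j))

-- By self-adjointness μ (x ⋅ y) = Lx ⋅ y = x ⋅ Ly = 0.
eigen-orthogonal-kernel : ∀ {n} {b : Adj n} → Symmetric b → ∀ {x y μ} →
  (∀ u → (laplacian b ∗ x) u ≡ μ * x u) → Kernel (laplacian b) y → μ ≢ 0ℚ → dot x y ≡ 0ℚ
eigen-orthogonal-kernel {n} {b} b-sym {x} {y} {μ} Lx≡μx Ly≡0 μ≢0 = *-cancelˡ-0 μ≢0 (begin
  μ * dot x y                    ≡⟨ *-distribˡ-Σ n μ _ ⟩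
  Σℚ n (λ u → μ * (x u * y u))   ≡⟨ Σ-cong n (λ u → trans (sym (*-assoc μ (x u) (y u))) (cong (_* y u) (sym (Lx≡μx u)))) ⟩
  dot (laplacian b ∗ x) y        ≡⟨ laplacian-selfAdjoint {b = b} b-sym x y ⟩
  dot x (laplacian b ∗ y)        ≡⟨ Σ-zero n (λ u → trans (cong (x u *_) (Ly≡0 u)) (*-zeroʳ (x u))) ⟩
  0ℚ                             ∎)

ones-kernel : ∀ {n} (b : Adj n) → Kernel (laplacian b) (λ _ → 1ℚ)
ones-kernel b = adjacent-kernel b λ _ → refl

eigen-sum-zero : ∀ {n} {b : Adj n} → Symmetric b → ∀ {x μ} →
  (∀ u → (laplacian b ∗ x) u ≡ μ * x u) → μ ≢ 0ℚ → Σℚ n x ≡ 0ℚ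
eigen-sum-zero {n} {b} b-sym {x} Lx≡μx μ≢0 = trans (Σ-cong n λ u → sym (*-identityʳ (x u)))
  (eigen-orthogonal-kernel {b = b} b-sym Lx≡μx (ones-kernel b) μ≢0)

-- For each column, Pⱼ ⋅ Lw = μⱼ (Pⱼ ⋅ w) vanishes, either because μⱼ does or by hypothesis. Since
-- the transpose of `P` is invertible, Lw = 0.
orthogonal-kernel : ∀ {n} {b : Adj n} → Symmetric b → ∀ {P} (E : Eigenbasis b P) {w} →
  (∀ j → Eigenbasis.eigenvalue E j ≢ 0ℚ → dot (column P j) w ≡ 0ℚ) → Kernel (laplacian b) w
orthogonal-kernel {n} {b} b-sym {P} E {w} w⊥ u = begin
  Lw u                                                       ≡⟨ sym (leftInverse-∗ {Q = transpose inv} {transpose P} QᵀPᵀ Lw u) ⟩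
  (transpose inv ∗ transpose P ∗ Lw) u                       ≡⟨ ∗-zero (transpose inv) Pⱼ⊥Lw u ⟩
  0ℚ                                                         ∎
  where
  open Eigenbasis E
  Lw : Vector n
  Lw = laplacian b ∗ w
  QᵀPᵀ : ∀ i j → (transpose inv · transpose P) i j ≡ identity n i j
  QᵀPᵀ i j = trans (dot-comm (column inv i) (P j)) (trans (inv-right j i)
    (trans (identity-δ j i) (trans (δ-sym j i) (sym (identity-δ i j)))))
  μ*dot : ∀ j → Dec (eigenvalue j ≡ 0ℚ) → eigenvalue j * dot (column P j) w ≡ 0ℚ
  μ*dot j (yes μ≡0) = trans (cong (_* dot (column P j) w) μ≡0) (*-zeroˡ (dot (column P j) w))
  μ*dot j (no μ≢0)  = trans (cong (eigenvalue j *_) (w⊥ j μ≢0)) (*-zeroʳ (eigenvalue j))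
  Pⱼ⊥Lw : ∀ j → dot (column P j) Lw ≡ 0ℚ
  Pⱼ⊥Lw j = begin
    dot (column P j) Lw                       ≡⟨ sym (laplacian-selfAdjoint {b = b} b-sym (column P j) w) ⟩
    dot (laplacian b ∗ column P j) w          ≡⟨ Σ-cong n (λ u → trans (cong (_* w u) (eigen j u)) (*-assoc (eigenvalue j) (P u j) (w u))) ⟩
    Σℚ n (λ u → eigenvalue j * (P u j * w u)) ≡⟨ sym (*-distribˡ-Σ n (eigenvalue j) _) ⟩
    eigenvalue j * dot (column P j) w         ≡⟨ μ*dot j (eigenvalue j ≟ 0ℚ) ⟩
    0ℚ                                        ∎

-- The kernel consists of the vectors that factor through `c`. Stating this for an arbitrary
-- labelling lets the dimension count serve both `a`, with its components, and the connected
-- complement, with a single label.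
record KernelFibres {n p : ℕ} (b : Adj n) (c : Fin n → Fin p) : Set where
  field
    onto           : ∀ k → ∃ λ u → c u ≡ k
    kernel-factors : ∀ {x} → Kernel (laplacian b) x → ∀ {u v} → c u ≡ c v → x u ≡ x v
    factors-kernel : ∀ (y : Vector p) → Kernel (laplacian b) (λ u → y (c u))

  section : Fin p → Fin n
  section k = proj₁ (onto k)

  section-right : ∀ k → c (section k) ≡ k
  section-right k = proj₂ (onto k)

labelling-fibres : ∀ {n p} {a : Adj n} → Symmetric a → {c : Fin n → Fin p} →
  IsComponentLabelling a c → KernelFibres a c
labelling-fibres {a = a} a-sym (c-onto , c-reach) = record
  { onto           = c-onto
  ; kernel-factors = λ Lx≡0 {u} {v} cu≡cv → kernel-reachable {b = a} a-sym Lx≡0 (Equivalence.to (c-reach u v) cu≡cv)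
  ; factors-kernel = λ y → adjacent-kernel a λ {u} {v} auv →
      cong y (Equivalence.from (c-reach u v) (step auv here))
  }

connected-fibres : ∀ {n} {b : Adj n} → Connected b → Fin n → KernelFibres b (λ _ → fzero {0})
connected-fibres {b = b} conn u₀ = record
  { onto           = λ { fzero → u₀ , refl }
  ; kernel-factors = λ Lx≡0 _ → conn _ Lx≡0 _ _
  ; factors-kernel = λ y → adjacent-kernel b λ _ → refl
  }

module _ {n p : ℕ} (c : Fin n → Fin p) where

  componentSizes-Σ : ∀ k → componentSizes c k ≡ Σℚ n (λ u → δ (c u) k)
  componentSizes-Σ k = count-Σ n (λ u → does (c u ≟F k))

  -- Double counting, grouped by label. It translates size-weighted sums over components into sums
  -- over vertices.
  Σ-fibres : ∀ y → Σℚ p (λ k → componentSizes c k * y k) ≡ Σℚ n (λ u → y (c u))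
  Σ-fibres y = begin
    Σℚ p (λ k → componentSizes c k * y k)          ≡⟨ Σ-cong p (λ k → trans (cong (_* y k) (componentSizes-Σ k)) (*-distribʳ-Σ n (y k) _)) ⟩
    Σℚ p (λ k → Σℚ n (λ u → δ (c u) k * y k))      ≡⟨ Σ-swap p n _ ⟩
    Σℚ n (λ u → Σℚ p (λ k → δ (c u) k * y k))      ≡⟨ Σ-cong n (λ u → Σ-δ p (c u) y) ⟩
    Σℚ n (λ u → y (c u))                           ∎

  componentSizes-≢0 : (∀ k → ∃ λ u → c u ≡ k) → ∀ k → componentSizes c k ≢ 0ℚ
  componentSizes-≢0 c-onto k size≡0 with c-onto k
  ... | u , refl = contradiction (trans (sym (δ-refl (c u))) (Σ-nonNeg-zero n δ-nonNeg (trans (sym (componentSizes-Σ k)) size≡0) u)) λ ()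
    where
    δ-nonNeg : ∀ u → 0ℚ ≤ δ (c u) k
    δ-nonNeg u with does (c u ≟F k)
    ... | true  = nonNegative⁻¹ 1ℚ
    ... | false = ≤-refl

isZero : ℚ → Bool
isZero μ = does (μ ≟ 0ℚ)

-- Applied to the coordinates of a kernel vector, this says that the eigenprojection onto the kernel
-- fixes it.
isZero-* : ∀ μ y → μ * y ≡ 0ℚ → toℚ (isZero μ) * y ≡ y
isZero-* μ y eq = go (μ ≟ 0ℚ)
  where
  go : (d : Dec (μ ≡ 0ℚ)) → toℚ (does d) * y ≡ y
  go (yes _)  = *-identityˡ y
  go (no μ≢0) = trans (cong (0ℚ *_) (*-cancelˡ-0 μ≢0 eq)) (sym (*-cancelˡ-0 μ≢0 eq))

-- The eigenprojection onto the kernel has trace p, since it fixes the p fibre indicators.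
kernel-dimension : ∀ {n p} {b : Adj n} {c : Fin n → Fin p} → KernelFibres b c →
  ∀ {P} (E : Eigenbasis b P) → count n (λ j → isZero (Eigenbasis.eigenvalue E j)) ≡ p
kernel-dimension {n} {p} {b} {c} F {P} E = natℚ-injective {count n (λ j → isZero (Eigenbasis.eigenvalue E j))} {p} (sym (begin
  natℚ p
    ≡⟨ sym (Σ-one p) ⟩
  Σℚ p (λ _ → 1ℚ)
    ≡⟨ Σ-cong p (λ k → trans (sym (trans (cong (λ l → δ l k) (section-right k)) (δ-refl k))) (diagonal-entry k)) ⟩
  Σℚ p (λ k → Σℚ n (λ j → z j * (P (s k) j * (inv ∗ indicator k) j)))
    ≡⟨ Σ-swap p n _ ⟩
  Σℚ n (λ j → Σℚ p (λ k → z j * (P (s k) j * (inv ∗ indicator k) j)))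
    ≡⟨ Σ-cong n trace-entry ⟩
  Σℚ n z
    ≡⟨ sym (count-Σ n (λ j → isZero (eigenvalue j))) ⟩
  natℚ (count n (λ j → isZero (eigenvalue j)))
    ∎))
  where
  open KernelFibres F
  open Eigenbasis E
  s = section
  z : Vector n
  z j = toℚ (isZero (eigenvalue j))
  indicator : Fin p → Vector n
  indicator k u = δ (c u) k
  -- Lx is `P` applied to the coordinates of x scaled by the eigenvalues, and `P` is injective.
  coordinate : ∀ {x} → Kernel (laplacian b) x → ∀ j → eigenvalue j * (inv ∗ x) j ≡ 0ℚ
  coordinate {x} Lx≡0 j = trans (sym (leftInverse-∗ {Q = inv} {P} inv-left μy j)) (∗-zero inv Pμy≡0 j)
    where
    y μy : Vector n
    y = inv ∗ x
    μy j = eigenvalue j * y j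
    Pμy≡0 : ∀ u → (P ∗ μy) u ≡ 0ℚ
    Pμy≡0 u = begin
      (P ∗ μy) u
        ≡⟨ Σ-cong n (λ j → trans (solve 3 (λ p m y → p :* (m :* y) := (m :* p) :* y) refl (P u j) (eigenvalue j) (y j))
             (cong (_* y j) (sym (eigen j u)))) ⟩
      ((laplacian b · P) ∗ y) u
        ≡⟨ sym (∗-assoc (laplacian b) P y u) ⟩
      (laplacian b ∗ P ∗ inv ∗ x) u
        ≡⟨ ∗-cong (laplacian b) (leftInverse-∗ {Q = P} {inv} inv-right x) u ⟩
      (laplacian b ∗ x) u
        ≡⟨ Lx≡0 u ⟩
      0ℚ
        ∎
  diagonal-entry : ∀ k → indicator k (s k) ≡ Σℚ n (λ j → z j * (P (s k) j * (inv ∗ indicator k) j))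
  diagonal-entry k = begin
    indicator k (s k)
      ≡⟨ sym (leftInverse-∗ {Q = P} {inv} inv-right (indicator k) (s k)) ⟩
    Σℚ n (λ j → P (s k) j * (inv ∗ indicator k) j)
      ≡⟨ Σ-cong n (λ j → trans (cong (P (s k) j *_) (sym (isZero-* (eigenvalue j) ((inv ∗ indicator k) j) (coordinate (factors-kernel (λ l → δ l k)) j))))
           (solve 3 (λ p z y → p :* (z :* y) := z :* (p :* y)) refl (P (s k) j) (z j) ((inv ∗ indicator k) j))) ⟩
    Σℚ n (λ j → z j * (P (s k) j * (inv ∗ indicator k) j))
      ∎
  -- A column with eigenvalue zero is constant on fibres, so its value at the representative may be
  -- replaced by its value at `u`; the sum over `u` then becomes a diagonal entry of `inv · P`.
  column-factors : ∀ j u → z j * (P (s (c u)) j * inv j u) ≡ z j * (inv j u * P u j)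
  column-factors j u with eigenvalue j ≟ 0ℚ in eq
  ... | no _    = trans (*-zeroˡ (P (s (c u)) j * inv j u)) (sym (*-zeroˡ (inv j u * P u j)))
  ... | yes μ≡0 = cong (1ℚ *_) (trans (cong (_* inv j u) (kernel-factors Pⱼ-kernel (section-right (c u)))) (*-comm (P u j) (inv j u)))
    where
    Pⱼ-kernel : Kernel (laplacian b) (column P j)
    Pⱼ-kernel u = trans (eigen j u) (trans (cong (_* P u j) μ≡0) (*-zeroˡ (P u j)))
  trace-entry : ∀ j → Σℚ p (λ k → z j * (P (s k) j * (inv ∗ indicator k) j)) ≡ z j
  trace-entry j = begin
    Σℚ p (λ k → z j * (P (s k) j * (inv ∗ indicator k) j))
      ≡⟨ Σ-cong p (λ k → trans (sym (*-assoc (z j) (P (s k) j) ((inv ∗ indicator k) j)))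
           (trans (*-distribˡ-Σ n (z j * P (s k) j) _)
             (Σ-cong n λ u → solve 4 (λ z p q d → (z :* p) :* (q :* d) := d :* (z :* (p :* q))) refl
               (z j) (P (s k) j) (inv j u) (δ (c u) k)))) ⟩
    Σℚ p (λ k → Σℚ n (λ u → δ (c u) k * (z j * (P (s k) j * inv j u))))
      ≡⟨ Σ-swap p n _ ⟩
    Σℚ n (λ u → Σℚ p (λ k → δ (c u) k * (z j * (P (s k) j * inv j u))))
      ≡⟨ Σ-cong n (λ u → trans (Σ-δ p (c u) (λ k → z j * (P (s k) j * inv j u))) (column-factors j u)) ⟩
    Σℚ n (λ u → z j * (inv j u * P u j))
      ≡⟨ sym (*-distribˡ-Σ n (z j) _) ⟩
    z j * (inv · P) j j
      ≡⟨ cong (z j *_) (trans (inv-left j j) (trans (identity-δ j j) (δ-refl j))) ⟩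
    z j * 1ℚ
      ≡⟨ *-identityʳ (z j) ⟩
    z j
      ∎

-- Increasing enumeration of a subset of indices

select : ∀ n (b : Fin n → Bool) → Fin (count n b) → Fin n
select (suc n) b i with b fzero
select (suc n) b fzero    | true  = fzero
select (suc n) b (fsuc i) | true  = fsuc (select n (λ i → b (fsuc i)) i)
select (suc n) b i        | false = fsuc (select n (λ i → b (fsuc i)) i)

select-true : ∀ n (b : Fin n → Bool) i → b (select n b i) ≡ true
select-true (suc n) b i with b fzero in eq
select-true (suc n) b fzero    | true  = eq
select-true (suc n) b (fsuc i) | true  = select-true n _ i
select-true (suc n) b i        | false = select-true n _ i

select-onto : ∀ n (b : Fin n → Bool) j → b j ≡ true → ∃ λ i → select n b i ≡ j
select-onto (suc n) b j bj with b fzero in eq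
select-onto (suc n) b fzero    bj | true  = fzero , refl
select-onto (suc n) b (fsuc j) bj | true  with select-onto n (λ i → b (fsuc i)) j bj
... | i , refl = fsuc i , refl
select-onto (suc n) b fzero    bj | false = contradiction (trans (sym eq) bj) λ ()
select-onto (suc n) b (fsuc j) bj | false with select-onto n (λ i → b (fsuc i)) j bj
... | i , refl = i , refl

select-expands : ∀ n (b : Fin n → Bool) i → toℕ i ℕ.≤ toℕ (select n b i)
select-expands (suc n) b i with b fzero
select-expands (suc n) b fzero    | true  = ℕ.z≤n
select-expands (suc n) b (fsuc i) | true  = s≤s (select-expands n _ i)
select-expands (suc n) b i        | false = ℕ.m≤n⇒m≤1+n (select-expands n _ i)

-- An increasing enumeration never shrinks distances. Hence discarding columns of a matrix cannot
-- enlarge the bandwidth of its Gram matrix.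
select-distance : ∀ n (b : Fin n → Bool) i j →
  ∣ toℕ i - toℕ j ∣ ℕ.≤ ∣ toℕ (select n b i) - toℕ (select n b j) ∣
select-distance (suc n) b i j with b fzero
select-distance (suc n) b fzero    fzero    | true  = ℕ.z≤n
select-distance (suc n) b fzero    (fsuc j) | true  = s≤s (select-expands n _ j)
select-distance (suc n) b (fsuc i) fzero    | true  = s≤s (select-expands n _ i)
select-distance (suc n) b (fsuc i) (fsuc j) | true  = select-distance n _ i j
select-distance (suc n) b i        j        | false = select-distance n _ i j

-- Complementary graphs

natℚ-≢0 : ∀ {n} → Fin n → natℚ n ≢ 0ℚ
natℚ-≢0 {suc n} _ eq = contradiction (natℚ-injective {suc n} {0} eq) λ ()

isZero-∧-not : ∀ κ μ → isZero κ ∧ not (isZero μ) ≡ true → κ ≡ 0ℚ × μ ≢ 0ℚ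
isZero-∧-not κ μ eq with κ ≟ 0ℚ | μ ≟ 0ℚ
... | yes κ≡0 | no μ≢0 = κ≡0 , μ≢0

-- The identity L + L' = n I - J as a relation between two graphs. It is symmetric, so eigenvectors
-- can be carried back from the complement without computing a double complement.
Complementary : ∀ {n} → Adj n → Adj n → Set
Complementary {n} b b' = ∀ x u → (laplacian b ∗ x) u + (laplacian b' ∗ x) u ≡ Σℚ n (λ v → x u - x v)

Complementary-sym : ∀ {n} {b b' : Adj n} → Complementary b b' → Complementary b' b
Complementary-sym {b = b} {b'} H x u = trans (+-comm ((laplacian b' ∗ x) u) ((laplacian b ∗ x) u)) (H x u)

complementary-eigen : ∀ {n} {b b' : Adj n} → Complementary b b' → ∀ {x μ} → Σℚ n x ≡ 0ℚ →
  (∀ u → (laplacian b ∗ x) u ≡ μ * x u) → ∀ u → (laplacian b' ∗ x) u ≡ (natℚ n - μ) * x u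
complementary-eigen {n} {b} {b'} H {x} {μ} Σx≡0 Lx≡μx u = begin
  (laplacian b' ∗ x) u
    ≡⟨ solve 2 (λ p q → q := (p :+ q) :+ :- p) refl ((laplacian b ∗ x) u) ((laplacian b' ∗ x) u) ⟩
  (laplacian b ∗ x) u + (laplacian b' ∗ x) u - (laplacian b ∗ x) u
    ≡⟨ cong₂ _-_ (H x u) (Lx≡μx u) ⟩
  Σℚ n (λ v → x u - x v) - μ * x u
    ≡⟨ cong (_- μ * x u) (Σ-cong n (λ v → solve 2 (λ p q → p :+ :- q := con 1ℚ :* p :+ (:- con 1ℚ) :* q) refl (x u) (x v))) ⟩
  Σℚ n (λ v → 1ℚ * x u + - 1ℚ * x v) - μ * x u
    ≡⟨ cong (_- μ * x u) (Σ-distrib-+ n (λ _ → 1ℚ * x u) (λ v → - 1ℚ * x v)) ⟩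
  Σℚ n (λ v → 1ℚ * x u) + Σℚ n (λ v → - 1ℚ * x v) - μ * x u
    ≡⟨ cong₂ (λ p q → p + q - μ * x u)
         (trans (sym (*-distribʳ-Σ n (x u) (λ _ → 1ℚ))) (cong (_* x u) (Σ-one n)))
         (trans (sym (*-distribˡ-Σ n (- 1ℚ) x)) (cong (- 1ℚ *_) Σx≡0)) ⟩
  natℚ n * x u + - 1ℚ * 0ℚ - μ * x u
    ≡⟨ solve 3 (λ k m y → k :* y :+ (:- con 1ℚ) :* con 0ℚ :+ :- (m :* y) := (k :+ :- m) :* y) refl (natℚ n) μ (x u) ⟩
  (natℚ n - μ) * x u
    ∎

-- The map of eigenvalues from a connected graph: the eigenvalue 0 belongs to constant vectors,
-- which stay in the kernel; only the others are reflected.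
complementEigenvalue : ℕ → ℚ → ℚ
complementEigenvalue n μ with μ ≟ 0ℚ
... | yes _ = 0ℚ
... | no _  = natℚ n - μ

complementEigenvalue-zero : ∀ n {μ} → μ ≡ 0ℚ → complementEigenvalue n μ ≡ 0ℚ
complementEigenvalue-zero n refl = refl

-- A column with nonzero eigenvalue has sum zero, so it stays an eigenvector; a column with
-- eigenvalue zero is constant by connectedness, so it lies in both kernels.
connected-complementary-eigenbasis : ∀ {n} {b b' : Adj n} → Symmetric b → Connected b → Complementary b b' →
  ∀ {P} → Eigenbasis b P → Eigenbasis b' P
connected-complementary-eigenbasis {n} {b} {b'} b-sym conn H {P} E = record
  { inv = inv ; inv-left = inv-left ; inv-right = inv-right
  ; eigenvalue = λ j → complementEigenvalue n (eigenvalue j)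
  ; eigen = eigen'
  }
  where
  open Eigenbasis E
  eigen' : ∀ j u → (laplacian b' ∗ column P j) u ≡ complementEigenvalue n (eigenvalue j) * P u j
  eigen' j u with eigenvalue j ≟ 0ℚ
  ... | no μ≢0  = complementary-eigen {b = b} {b'} H (eigen-sum-zero {b = b} b-sym (eigen j) μ≢0) (eigen j) u
  ... | yes μ≡0 = trans (adjacent-kernel b' (λ {v} {w} _ → conn (column P j) Pⱼ-kernel v w) u) (sym (*-zeroˡ (P u j)))
    where
    Pⱼ-kernel : Kernel (laplacian b) (column P j)
    Pⱼ-kernel v = trans (eigen j v) (trans (cong (_* P v j) μ≡0) (*-zeroˡ (P v j)))

-- Graphs with at least two components

module _ {n q : ℕ} {a : Adj n} (a-sym : Symmetric a) {c : Fin n → Fin (suc (suc q))}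
         (labelling : IsComponentLabelling a c) where

  private
    v : Vector (suc (suc q))
    v = componentSizes c
    F : KernelFibres a c
    F = labelling-fibres a-sym labelling
    open KernelFibres F
    aᶜ : Adj n
    aᶜ = complement a
    aᶜ-sym : Symmetric aᶜ
    aᶜ-sym = complement-symmetric {a = a} a-sym
    aᶜ-connected : Connected aᶜ
    aᶜ-connected = complement-connected {a = a} a-sym labelling
    v≢0 : ∀ k → v k ≢ 0ℚ
    v≢0 = componentSizes-≢0 c onto

    reciprocal : ∀ k → ∃ λ r → r * v k ≡ 1ℚ
    reciprocal k = 1/ v k , *-inverseˡ (v k)
      where instance _ = ≢-nonZero (v≢0 k)

  -- The chosen columns lie in the kernel of L, so their values at one representative per component
  -- determine them; these values form the rows of `A`. A null vector of `A` yields a vector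
  -- orthogonal to every column outside the kernel of Lᶜ, hence a constant one.
  balanced : ∀ {P} → Entries±1 P → Eigenbasis aᶜ P → Balanced (suc (suc q)) v
  balanced {P} P±1 Eᶜ = A , (λ i k → P±1 (section k) (e i)) , λ x → mk⇔ (to x) (from x)
    where
    E : Eigenbasis a P
    E = connected-complementary-eigenbasis {b = aᶜ} {a} aᶜ-sym aᶜ-connected
          (Complementary-sym {b = a} {aᶜ} (laplacian-complement a)) Eᶜ
    module E = Eigenbasis E
    module Eᶜ = Eigenbasis Eᶜ
    μ κ : Vector n
    μ = Eᶜ.eigenvalue
    κ = E.eigenvalue
    inA inAᶜ S : Fin n → Bool
    inA j = isZero (κ j)
    inAᶜ j = isZero (μ j)
    -- The columns whose eigenvalue for Lᶜ is n: nonzero there, and reflected to zero for L.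
    S j = inA j ∧ not (inAᶜ j)
    inAᶜ⇒inA : ∀ j → inA j ∧ inAᶜ j ≡ inAᶜ j
    inAᶜ⇒inA j = go (μ j ≟ 0ℚ)
      where
      go : (d : Dec (μ j ≡ 0ℚ)) → inA j ∧ does d ≡ does d
      go (no _) = ∧-zeroʳ (inA j)
      go (yes μ≡0) = cong (_∧ true) (dec-true (κ j ≟ 0ℚ) (complementEigenvalue-zero n μ≡0))
    -- L has p kernel columns, among them the single kernel column of the connected complement; p -
    -- 1 remain.
    S-count : suc q ≡ count n S
    S-count = ℕ.suc-injective (begin
      suc (suc q)                                       ≡⟨ sym (kernel-dimension F E) ⟩
      count n inA                                       ≡⟨ count-split n inA inAᶜ ⟩
      count n (λ j → inA j ∧ inAᶜ j) ℕ.+ count n S      ≡⟨ cong (ℕ._+ count n S) (count-cong n inAᶜ⇒inA) ⟩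
      count n inAᶜ ℕ.+ count n S                        ≡⟨ cong (ℕ._+ count n S) (kernel-dimension (connected-fibres aᶜ-connected (section fzero)) Eᶜ) ⟩
      suc (count n S)                                   ∎)
    e : Fin (suc q) → Fin n
    e i = select n S (cast S-count i)
    e-onto : ∀ j → S j ≡ true → ∃ λ i → e i ≡ j
    e-onto j Sj = cast (sym S-count) i ,
      trans (cong (select n S) (cast-involutive S-count (sym S-count) i)) (proj₂ (select-onto n S j Sj))
      where
      i : Fin (count n S)
      i = proj₁ (select-onto n S j Sj)
    e-kernel : ∀ i → κ (e i) ≡ 0ℚ × μ (e i) ≢ 0ℚ
    e-kernel i = isZero-∧-not (κ (e i)) (μ (e i)) (select-true n S (cast S-count i))
    A : Mat (suc q) (suc (suc q))
    A i k = P (section k) (e i)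
    A-column : ∀ i u → A i (c u) ≡ P u (e i)
    A-column i u = kernel-factors Pₑ-kernel (section-right (c u))
      where
      Pₑ-kernel : Kernel (laplacian a) (column P (e i))
      Pₑ-kernel w = trans (E.eigen (e i) w) (trans (cong (_* P w (e i)) (proj₁ (e-kernel i))) (*-zeroˡ (P w (e i))))
    from : ∀ x → (∃ λ t → ∀ k → x k ≡ t * v k) → Kernel A x
    from x (t , x≡tv) i = begin
      (A ∗ x) i
        ≡⟨ Σ-cong (suc (suc q)) {λ k → A i k * x k} {λ k → t * (v k * A i k)} (λ k → trans (cong (A i k *_) (x≡tv k))
             (solve 3 (λ y t v → y :* (t :* v) := t :* (v :* y)) refl (A i k) t (v k))) ⟩
      Σℚ (suc (suc q)) (λ k → t * (v k * A i k))
        ≡⟨ sym (*-distribˡ-Σ (suc (suc q)) t (λ k → v k * A i k)) ⟩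
      t * Σℚ (suc (suc q)) (λ k → v k * A i k)
        ≡⟨ cong (t *_) (Σ-fibres c (A i)) ⟩
      t * Σℚ n (λ u → A i (c u))
        ≡⟨ cong (t *_) (trans (Σ-cong n (A-column i)) (eigen-sum-zero {b = aᶜ} aᶜ-sym (Eᶜ.eigen (e i)) (proj₂ (e-kernel i)))) ⟩
      t * 0ℚ
        ≡⟨ *-zeroʳ t ⟩
      0ℚ
        ∎
    to : ∀ x → Kernel A x → ∃ λ t → ∀ k → x k ≡ t * v k
    to x Ax≡0 = w (section fzero) , λ k → begin
      x k                      ≡⟨ sym (vy≡x k) ⟩
      v k * y k                ≡⟨ cong (λ l → v k * y l) (sym (section-right k)) ⟩
      v k * w (section k)      ≡⟨ cong (v k *_) (w-constant (section k) (section fzero)) ⟩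
      v k * w (section fzero)  ≡⟨ *-comm (v k) (w (section fzero)) ⟩
      w (section fzero) * v k  ∎
      where
      y : Vector (suc (suc q))
      -- Dividing by the sizes compensates the weights of `Σ-fibres`: A x = 0 becomes orthogonality
      -- of the lift `w` to the chosen columns.
      y k = proj₁ (reciprocal k) * x k
      w : Vector n
      w u = y (c u)
      vy≡x : ∀ k → v k * y k ≡ x k
      vy≡x k = begin
        v k * (r * x k)   ≡⟨ solve 3 (λ v r x → v :* (r :* x) := (r :* v) :* x) refl (v k) r (x k) ⟩
        r * v k * x k     ≡⟨ cong (_* x k) (proj₂ (reciprocal k)) ⟩
        1ℚ * x k          ≡⟨ *-identityˡ (x k) ⟩
        x k               ∎
        where
        r : ℚ
        r = proj₁ (reciprocal k)
      w⊥A : ∀ i → dot (column P (e i)) w ≡ 0ℚ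
      w⊥A i = begin
        Σℚ n (λ u → P u (e i) * w u)
          ≡⟨ Σ-cong n (λ u → cong (_* w u) (sym (A-column i u))) ⟩
        Σℚ n (λ u → A i (c u) * y (c u))
          ≡⟨ sym (Σ-fibres c (λ k → A i k * y k)) ⟩
        Σℚ (suc (suc q)) (λ k → v k * (A i k * y k))
          ≡⟨ Σ-cong (suc (suc q)) {λ k → v k * (A i k * y k)} {λ k → A i k * x k}
               (λ k → trans (solve 3 (λ v p y → v :* (p :* y) := p :* (v :* y)) refl (v k) (A i k) (y k)) (cong (A i k *_) (vy≡x k))) ⟩
        (A ∗ x) i
          ≡⟨ Ax≡0 i ⟩
        0ℚ
          ∎
      w⊥ : ∀ j → μ j ≢ 0ℚ → dot (column P j) w ≡ 0ℚ
      w⊥ j μ≢0 = go (κ j ≟ 0ℚ)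
        where
        go : Dec (κ j ≡ 0ℚ) → dot (column P j) w ≡ 0ℚ
        go (no κ≢0) = eigen-orthogonal-kernel {b = a} a-sym (E.eigen j) (factors-kernel y) κ≢0
        go (yes κ≡0) = subst (λ j → dot (column P j) w ≡ 0ℚ) (proj₂ i,eq) (w⊥A (proj₁ i,eq))
          where
          i,eq = e-onto j (cong₂ (λ s t → s ∧ not t) (dec-true (κ j ≟ 0ℚ) κ≡0) (dec-false (μ j ≟ 0ℚ) μ≢0))
      w-constant : Constant w
      w-constant = aᶜ-connected w (orthogonal-kernel {b = aᶜ} aᶜ-sym Eᶜ w⊥)

  complement-basis : ∀ {P} → Entries±1 P → Eigenbasis a P → Balanced (suc (suc q)) v →
    Σ (Mat n n) λ P' → Entries±1 P' × Diagonalizes aᶜ P' ×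
      (∀ k → BandwidthAtMost (transpose P · P) k → BandwidthAtMost (transpose P' · P') (suc q ⊔ k))
  complement-basis {P} P±1 E (A , A±1 , A-null) =
    P' , (λ u j → col±1 (block j) u) , eigenbasis⇒diagonalizes E' , bandwidth
    where
    module E = Eigenbasis E
    nonKernel : Fin n → Bool
    nonKernel j = not (isZero (E.eigenvalue j))
    m : ℕ
    m = count n nonKernel
    n≡m+p : n ≡ m ℕ.+ suc (suc q)
    n≡m+p = begin
      n                             ≡⟨ sym (count-true n) ⟩
      count n (λ _ → true)          ≡⟨ count-split n (λ _ → true) (λ j → isZero (E.eigenvalue j)) ⟩
      count n (λ j → isZero (E.eigenvalue j)) ℕ.+ m ≡⟨ cong (ℕ._+ m) (kernel-dimension F E) ⟩
      suc (suc q) ℕ.+ m             ≡⟨ ℕ.+-comm (suc (suc q)) m ⟩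
      m ℕ.+ suc (suc q)             ∎
    Index : Set
    Index = Fin m ⊎ Fin (suc (suc q))
    col : Index → Vector n
    col (inj₁ i)        u = P u (select n nonKernel i)
    col (inj₂ fzero)    u = 1ℚ
    col (inj₂ (fsuc i)) u = A i (c u)
    block : Fin n → Index
    block j = splitAt m (cast n≡m+p j)
    block-onto : ∀ s → ∃ λ j → block j ≡ s
    block-onto s = cast (sym n≡m+p) (join m _ s) ,
      trans (cong (splitAt m) (cast-involutive n≡m+p (sym n≡m+p) (join m _ s))) (splitAt-join m _ s)
    P' : Mat n n
    P' u j = col (block j) u
    col±1 : ∀ s u → (col s u ≡ - 1ℚ) ⊎ (col s u ≡ 0ℚ) ⊎ (col s u ≡ 1ℚ)
    col±1 (inj₁ i)        u = P±1 u (select n nonKernel i)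
    col±1 (inj₂ fzero)    u = inj₂ (inj₂ refl)
    col±1 (inj₂ (fsuc i)) u = A±1 i (c u)
    selected : ∀ i → E.eigenvalue (select n nonKernel i) ≢ 0ℚ
    selected i μ≡0 = contradiction (trans (sym (select-true n nonKernel i))
      (cong not (dec-true (E.eigenvalue (select n nonKernel i) ≟ 0ℚ) μ≡0))) λ ()
    kernelBlock : ∀ k → Kernel (laplacian a) (col (inj₂ k))
    kernelBlock fzero    = ones-kernel a
    kernelBlock (fsuc i) = factors-kernel (A i)
    A-sum-zero : ∀ i → Σℚ n (λ u → A i (c u)) ≡ 0ℚ
    A-sum-zero i = begin
      Σℚ n (λ u → A i (c u))
        ≡⟨ sym (Σ-fibres c (A i)) ⟩
      Σℚ (suc (suc q)) (λ k → v k * A i k)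
        ≡⟨ Σ-cong (suc (suc q)) {λ k → v k * A i k} {λ k → A i k * v k} (λ k → *-comm (v k) (A i k)) ⟩
      (A ∗ v) i
        ≡⟨ Equivalence.from (A-null v) (1ℚ , λ k → sym (*-identityˡ (v k))) i ⟩
      0ℚ
        ∎
    H : Complementary a aᶜ
    H = laplacian-complement a
    col-eigen : ∀ s → ∃ λ μ → ∀ u → (laplacian aᶜ ∗ col s) u ≡ μ * col s u
    col-eigen (inj₁ i) = natℚ n - E.eigenvalue (select n nonKernel i) , complementary-eigen {b = a} {aᶜ} H
      (eigen-sum-zero {b = a} a-sym (E.eigen (select n nonKernel i)) (selected i)) (E.eigen (select n nonKernel i))
    col-eigen (inj₂ fzero) = 0ℚ , λ u → trans (ones-kernel aᶜ u) (sym (*-zeroˡ 1ℚ))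
    col-eigen (inj₂ (fsuc i)) = natℚ n - 0ℚ , complementary-eigen {b = a} {aᶜ} H {μ = 0ℚ} (A-sum-zero i)
      (λ u → trans (kernelBlock (fsuc i) u) (sym (*-zeroˡ (A i (c u)))))
    P'ᵀ-injective : TrivialKernel (transpose P')
    P'ᵀ-injective w P'ᵀw≡0 u = begin
      w u            ≡⟨ w≡t u ⟩
      t              ≡⟨ t≡0 ⟩
      0ℚ             ∎
      where
      col⊥w : ∀ s → dot (col s) w ≡ 0ℚ
      col⊥w s = subst (λ s → dot (col s) w ≡ 0ℚ) (proj₂ (block-onto s)) (P'ᵀw≡0 (proj₁ (block-onto s)))
      w-kernel : Kernel (laplacian a) w
      w-kernel = orthogonal-kernel {b = a} a-sym E λ j μ≢0 → P⊥w j μ≢0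
        where
        P⊥w : ∀ j → E.eigenvalue j ≢ 0ℚ → dot (column P j) w ≡ 0ℚ
        P⊥w j μ≢0 = subst (λ j → dot (column P j) w ≡ 0ℚ) (proj₂ i,eq) (col⊥w (inj₁ (proj₁ i,eq)))
          where
          i,eq = select-onto n nonKernel j (cong not (dec-false (E.eigenvalue j ≟ 0ℚ) μ≢0))
      z : Vector (suc (suc q))
      z k = w (section k)
      w≡z : ∀ u → w u ≡ z (c u)
      w≡z u = kernel-factors w-kernel (sym (section-right (c u)))
      vz-null : ∀ i → (A ∗ (λ k → v k * z k)) i ≡ 0ℚ
      vz-null i = begin
        (A ∗ (λ k → v k * z k)) i
          ≡⟨ Σ-cong (suc (suc q)) {λ k → A i k * (v k * z k)} {λ k → v k * (A i k * z k)}
               (λ k → solve 3 (λ p v z → p :* (v :* z) := v :* (p :* z)) refl (A i k) (v k) (z k)) ⟩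
        Σℚ (suc (suc q)) (λ k → v k * (A i k * z k))
          ≡⟨ Σ-fibres c (λ k → A i k * z k) ⟩
        Σℚ n (λ u → A i (c u) * z (c u))
          ≡⟨ Σ-cong n (λ u → cong (A i (c u) *_) (sym (w≡z u))) ⟩
        dot (col (inj₂ (fsuc i))) w
          ≡⟨ col⊥w (inj₂ (fsuc i)) ⟩
        0ℚ
          ∎
      vz≡tv = Equivalence.to (A-null (λ k → v k * z k)) vz-null
      t : ℚ
      t = proj₁ vz≡tv
      w≡t : ∀ u → w u ≡ t
      w≡t u = trans (w≡z u) (difference-zero (*-cancelˡ-0 (v≢0 (c u)) (begin
        v (c u) * (z (c u) - t)           ≡⟨ solve 3 (λ v z t → v :* (z :+ :- t) := v :* z :+ :- (t :* v)) refl (v (c u)) (z (c u)) t ⟩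
        v (c u) * z (c u) - t * v (c u)   ≡⟨ cong (_- t * v (c u)) (proj₂ vz≡tv (c u)) ⟩
        t * v (c u) - t * v (c u)         ≡⟨ +-inverseʳ (t * v (c u)) ⟩
        0ℚ                                ∎)))
      t≡0 : t ≡ 0ℚ
      t≡0 = *-cancelˡ-0 (natℚ-≢0 (section fzero)) (begin
        natℚ n * t                ≡⟨ cong (_* t) (sym (Σ-one n)) ⟩
        Σℚ n (λ _ → 1ℚ) * t       ≡⟨ *-distribʳ-Σ n t (λ _ → 1ℚ) ⟩
        Σℚ n (λ _ → 1ℚ * t)       ≡⟨ Σ-cong n (λ u → cong (1ℚ *_) (sym (w≡t u))) ⟩
        dot (col (inj₂ fzero)) w  ≡⟨ col⊥w (inj₂ fzero) ⟩
        0ℚ                        ∎)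
    P'⁻¹ = inverse-transpose P' P'ᵀ-injective
    E' : Eigenbasis aᶜ P'
    E' = record
      { inv = proj₁ P'⁻¹ ; inv-left = proj₁ (proj₂ P'⁻¹) ; inv-right = proj₂ (proj₂ P'⁻¹)
      ; eigenvalue = λ j → proj₁ (col-eigen (block j))
      ; eigen = λ j → proj₂ (col-eigen (block j)) }
    position : Index → ℕ
    position s = toℕ (join m (suc (suc q)) s)
    block-position : ∀ j → toℕ j ≡ position (block j)
    block-position j = trans (sym (toℕ-cast n≡m+p j)) (cong toℕ (sym (join-splitAt m (suc (suc q)) (cast n≡m+p j))))
    kernelBlock-distance : ∀ k l → ∣ position (inj₂ k) - position (inj₂ l) ∣ ≡ ∣ toℕ k - toℕ l ∣
    kernelBlock-distance k l = trans (cong₂ ∣_-_∣ (toℕ-↑ʳ m k) (toℕ-↑ʳ m l)) (ℕ.∣m+n-m+o∣≡∣n-o∣ m (toℕ k) (toℕ l))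
    nonKernel-kernelBlock : ∀ i k → dot (col (inj₁ i)) (col (inj₂ k)) ≡ 0ℚ
    nonKernel-kernelBlock i k = eigen-orthogonal-kernel {b = a} a-sym (E.eigen (select n nonKernel i)) (kernelBlock k) (selected i)
    ones-A : ∀ i → dot (col (inj₂ fzero)) (col (inj₂ (fsuc i))) ≡ 0ℚ
    ones-A i = trans (Σ-cong n λ u → *-identityˡ (A i (c u))) (A-sum-zero i)
    distant : ∀ k → BandwidthAtMost (transpose P · P) k → ∀ s s' →
      suc q ⊔ k ℕ.≤ ∣ position s - position s' ∣ → dot (col s) (col s') ≡ 0ℚ
    distant k (_ , band) (inj₁ i) (inj₁ i') far = band (select n nonKernel i) (select n nonKernel i') (ℕ.≤-trans (ℕ.m⊔n≤o⇒n≤o (suc q) k far)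
      (ℕ.≤-trans (ℕ.≤-reflexive (cong₂ ∣_-_∣ (toℕ-↑ˡ i _) (toℕ-↑ˡ i' _))) (select-distance n nonKernel i i')))
    distant k _ (inj₁ i) (inj₂ l) far = nonKernel-kernelBlock i l
    distant k _ (inj₂ l) (inj₁ i) far = trans (dot-comm (col (inj₂ l)) (col (inj₁ i))) (nonKernel-kernelBlock i l)
    distant k _ (inj₂ fzero) (inj₂ fzero) far = contradiction
      (ℕ.≤-trans (ℕ.m⊔n≤o⇒m≤o (suc q) k far) (ℕ.≤-reflexive (kernelBlock-distance fzero fzero))) λ ()
    distant k _ (inj₂ fzero) (inj₂ (fsuc i)) far = ones-A i
    distant k _ (inj₂ (fsuc i)) (inj₂ fzero) far =
      trans (dot-comm (col (inj₂ (fsuc i))) (col (inj₂ fzero))) (ones-A i)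
    distant k _ (inj₂ (fsuc i)) (inj₂ (fsuc i')) far = contradiction
      (ℕ.≤-trans (ℕ.m⊔n≤o⇒m≤o (suc q) k far) (ℕ.≤-trans (ℕ.≤-reflexive (kernelBlock-distance (fsuc i) (fsuc i')))
        (ℕ.∣m-n∣≤m⊔n (toℕ i) (toℕ i'))))
      (ℕ.<⇒≱ (ℕ.⊔-pres-<m (toℕ<n i) (toℕ<n i')))
    bandwidth : ∀ k → BandwidthAtMost (transpose P · P) k → BandwidthAtMost (transpose P' · P') (suc q ⊔ k)
    bandwidth k band = ℕ.≤-trans (s≤s ℕ.z≤n) (ℕ.m≤m⊔n (suc q) k) , λ i j far →
      distant k band (block i) (block j)
        (subst₂ (λ x y → suc q ⊔ k ℕ.≤ ∣ x - y ∣) (block-position i) (block-position j) far)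

labelling-connected : ∀ {n p} {a : Adj n} → Symmetric a → {c : Fin n → Fin p} →
  IsComponentLabelling a c → (∀ (k l : Fin p) → k ≡ l) → Connected a
labelling-connected a-sym {c} labelling p≤1 x Lx≡0 u v =
  KernelFibres.kernel-factors (labelling-fibres a-sym labelling) Lx≡0 (p≤1 (c u) (c v))

theorem4p8 : (n : ℕ) (a : Adj n) → IsSimple a → Diagonalizable a →
    (p : ℕ) (c : Fin n → Fin p) → IsComponentLabelling a c →
    (Diagonalizable (complement a) ⇔ Balanced p (componentSizes c)) ×
    (∀ k → Balanced p (componentSizes c) → HasBandwidth a k →
    BandwidthGraphAtMost (complement a) ((p ∸ 1) ⊔ k))
theorem4p8 n a (a-sym , _) (P , P±1 , P-diag) p c labelling = thm p c labelling
  where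
  same : ∀ {p c} → IsComponentLabelling {p = p} a c → (∀ (k l : Fin p) → k ≡ l) →
    ∀ {P} → Diagonalizes a P → Diagonalizes (complement a) P
  same labelling p≤1 P-diag = eigenbasis⇒diagonalizes {b = complement a}
    (connected-complementary-eigenbasis {b = a} {complement a} a-sym
      (labelling-connected a-sym labelling p≤1) (laplacian-complement a) (diagonalizes⇒eigenbasis a P-diag))
  thm : ∀ p (c : Fin n → Fin p) → IsComponentLabelling a c →
    (Diagonalizable (complement a) ⇔ Balanced p (componentSizes c)) ×
    (∀ k → Balanced p (componentSizes c) → HasBandwidth a k →
    BandwidthGraphAtMost (complement a) ((p ∸ 1) ⊔ k))
  thm 0 c labelling =
    mk⇔ (λ _ → (λ ()) , (λ ()) , λ x → mk⇔ (λ _ → 0ℚ , λ ()) (λ _ ())) (λ _ → P , P±1 , same labelling (λ ()) P-diag) ,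
    λ { k _ (1≤k , (B , B±1 , B-diag , band) , _) → k , 1≤k , ℕ.≤-refl , B , B±1 , same labelling (λ ()) B-diag , band }
  thm 1 c labelling =
    mk⇔ (λ _ → componentSizes-≢0 c (proj₁ labelling) fzero) (λ _ → P , P±1 , same labelling p≤1 P-diag) ,
    λ { k _ (1≤k , (B , B±1 , B-diag , band) , _) → k , 1≤k , ℕ.≤-refl , B , B±1 , same labelling p≤1 B-diag , band }
    where
    p≤1 : ∀ (k l : Fin 1) → k ≡ l
    p≤1 fzero fzero = refl
  thm (suc (suc q)) c labelling =
    mk⇔ (λ { (B , B±1 , B-diag) → balanced a-sym labelling B±1 (diagonalizes⇒eigenbasis (complement a) B-diag) })
        (λ bal → let P' , P'±1 , P'-diag , _ = complement-basis a-sym labelling P±1 (diagonalizes⇒eigenbasis a P-diag) bal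
                 in P' , P'±1 , P'-diag) ,
    λ { k bal (1≤k , (B , B±1 , B-diag , band) , _) →
      let P' , P'±1 , P'-diag , bw = complement-basis a-sym labelling B±1 (diagonalizes⇒eigenbasis a B-diag) bal
      in suc q ⊔ k , ℕ.≤-trans 1≤k (ℕ.m≤n⊔m (suc q) k) , ℕ.≤-refl , P' , P'±1 , P'-diag , bw k band }
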